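{- Let $G=(V,E)$ be a connected claw-free graph with clique number $\omega(G)=3$. Then one of the following is true: (i) $G$ is the icosahedron; (ii) $G$ is the line graph $L(F)$ of a $3$-regular graph $F$; or (iii) there exists $v\in V$ with $\deg_{G^2}(v)\le 9$ such that $\deg_{G^2}(x)\le 11$ for all $x\in N_G(v)$; furthermore, either there exists $x^*\in N_G(v)$ with $\deg_{G^2}(x^*)\le 10$, or $N_G(v)$ induces a clique in $(G\setminus v)^2$.
   Context: A graph is claw-free if it has no induced $K_{1,3}$. The square $H^2$ of a graph $H$ is the graph on $V(H)$ in which two distinct vertices are adjacent iff they are at distance at most $2$ in $H$. $\deg_{G^2}(v)$ is the degree of $v$ in $G^2$; $N_G(v)$ is the open neighbourhood of $v$ in $G$; $G\setminus v$ is $G$ with $v$ deleted. -}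

module Defs where

open import Data.Nat using (ℕ; zero; suc; _≤_; _<_)
open import Data.Bool using (Bool; true; false; _∧_; _∨_; not; T; if_then_else_)
open import Data.Bool.Properties using (∨-comm)
open import Data.Fin using (Fin; toℕ; punchIn; _≟_)
open import Data.List using (List; []; _∷_; map; allFin)
open import Data.Nat.ListAction using (sum)
open import Data.Bool.ListAction using (any)
open import Data.Product using (Σ; ∃; _×_; _,_)
open import Data.Sum using (_⊎_)
open import Relation.Nullary using (¬_; ⌊_⌋)
open import Relation.Binary.PropositionalEquality using (_≡_; _≢_; refl)
open import Relation.Binary.Construct.Closure.ReflexiveTransitive using (Star)
open import Function.Definitions using (Injective; Bijective)

record Graph (n : ℕ) : Set where
  field
    adj    : Fin n → Fin n → Bool
    sym    : ∀ u v → adj u v ≡ adj v u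
    irrefl : ∀ v → adj v v ≡ false
open Graph public

Adj : ∀ {n} → Graph n → Fin n → Fin n → Set
Adj G u v = T (adj G u v)

count : ∀ {n} → (Fin n → Bool) → ℕ
count {n} p = sum (map (λ u → if p u then 1 else 0) (allFin n))

deg : ∀ {n} → Graph n → Fin n → ℕ
deg G v = count (λ u → adj G v u)

sqAdj : ∀ {n} → Graph n → Fin n → Fin n → Bool
sqAdj {n} G u v =
  not ⌊ u ≟ v ⌋ ∧ (adj G u v ∨ any (λ w → adj G u w ∧ adj G w v) (allFin n))

SqAdj : ∀ {n} → Graph n → Fin n → Fin n → Set
SqAdj G u v = T (sqAdj G u v)

deg² : ∀ {n} → Graph n → Fin n → ℕ
deg² G v = count (λ u → sqAdj G v u)

delete : ∀ {n} → Graph (suc n) → Fin (suc n) → Graph n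
delete G v = record
  { adj    = λ x y → adj G (punchIn v x) (punchIn v y)
  ; sym    = λ x y → sym G (punchIn v x) (punchIn v y)
  ; irrefl = λ x → irrefl G (punchIn v x)
  }

Connected : ∀ {n} → Graph n → Set
Connected G = ∀ u v → Star (Adj G) u v

ClawFree : ∀ {n} → Graph n → Set
ClawFree G = ∀ v a b c → Adj G v a → Adj G v b → Adj G v c →
  a ≢ b → a ≢ c → b ≢ c →
  ¬ (¬ Adj G a b × ¬ Adj G a c × ¬ Adj G b c)

HasClique : ∀ {n} → Graph n → ℕ → Set
HasClique {n} G k = Σ (Fin k → Fin n) λ f →
  Injective _≡_ _≡_ f × (∀ i j → i ≢ j → Adj G (f i) (f j))

CliqueNumber : ∀ {n} → Graph n → ℕ → Set
CliqueNumber G k = HasClique G k × (∀ m → HasClique G m → m ≤ k)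

Iso : ∀ {n m} → Graph n → Graph m → Set
Iso {n} {m} G H = Σ (Fin n → Fin m) λ f →
  Bijective _≡_ _≡_ f × (∀ u v → adj G u v ≡ adj H (f u) (f v))

Cubic : ∀ {m} → Graph m → Set
Cubic F = ∀ v → deg F v ≡ 3

IsLineGraphOf : ∀ {n m} → Graph n → Graph m → Set
IsLineGraphOf {n} {m} G F = Σ (Fin n → Fin m × Fin m) λ e →
  (∀ x → let (a , b) = e x in toℕ a < toℕ b × Adj F a b) ×
  Injective _≡_ _≡_ e ×
  (∀ a b → toℕ a < toℕ b → Adj F a b → ∃ λ x → e x ≡ (a , b)) ×
  (∀ x y → let (a , b) = e x ; (c , d) = e y in
     (Adj G x y → x ≢ y × (a ≡ c ⊎ a ≡ d ⊎ b ≡ c ⊎ b ≡ d)) ×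
     (x ≢ y × (a ≡ c ⊎ a ≡ d ⊎ b ≡ c ⊎ b ≡ d) → Adj G x y))

-- The icosahedron: 0 top, 1..5 upper pentagon, 6..10 lower pentagon,
-- 11 bottom.

icoEdges : List (ℕ × ℕ)
icoEdges =
  (0 , 1) ∷ (0 , 2) ∷ (0 , 3) ∷ (0 , 4) ∷ (0 , 5) ∷
  (1 , 2) ∷ (2 , 3) ∷ (3 , 4) ∷ (4 , 5) ∷ (5 , 1) ∷
  (1 , 6) ∷ (1 , 7) ∷ (2 , 7) ∷ (2 , 8) ∷ (3 , 8) ∷
  (3 , 9) ∷ (4 , 9) ∷ (4 , 10) ∷ (5 , 10) ∷ (5 , 6) ∷
  (6 , 7) ∷ (7 , 8) ∷ (8 , 9) ∷ (9 , 10) ∷ (10 , 6) ∷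
  (11 , 6) ∷ (11 , 7) ∷ (11 , 8) ∷ (11 , 9) ∷ (11 , 10) ∷ []

open import Data.Nat using (_≡ᵇ_)

icoE : Fin 12 → Fin 12 → Bool
icoE u v = any (λ { (a , b) → (toℕ u ≡ᵇ a) ∧ (toℕ v ≡ᵇ b) }) icoEdges

icoIrrefl : ∀ v → (icoE v v ∨ icoE v v) ≡ false
icoIrrefl Fin.zero = refl
icoIrrefl (Fin.suc Fin.zero) = refl
icoIrrefl (Fin.suc (Fin.suc Fin.zero)) = refl
icoIrrefl (Fin.suc (Fin.suc (Fin.suc Fin.zero))) = refl
icoIrrefl (Fin.suc (Fin.suc (Fin.suc (Fin.suc Fin.zero)))) = refl
icoIrrefl (Fin.suc (Fin.suc (Fin.suc (Fin.suc (Fin.suc Fin.zero))))) = refl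
icoIrrefl (Fin.suc (Fin.suc (Fin.suc (Fin.suc (Fin.suc (Fin.suc Fin.zero)))))) = refl
icoIrrefl (Fin.suc (Fin.suc (Fin.suc (Fin.suc (Fin.suc (Fin.suc (Fin.suc Fin.zero))))))) = refl
icoIrrefl (Fin.suc (Fin.suc (Fin.suc (Fin.suc (Fin.suc (Fin.suc (Fin.suc (Fin.suc Fin.zero)))))))) = refl
icoIrrefl (Fin.suc (Fin.suc (Fin.suc (Fin.suc (Fin.suc (Fin.suc (Fin.suc (Fin.suc (Fin.suc Fin.zero))))))))) = refl
icoIrrefl (Fin.suc (Fin.suc (Fin.suc (Fin.suc (Fin.suc (Fin.suc (Fin.suc (Fin.suc (Fin.suc (Fin.suc Fin.zero)))))))))) = refl
icoIrrefl (Fin.suc (Fin.suc (Fin.suc (Fin.suc (Fin.suc (Fin.suc (Fin.suc (Fin.suc (Fin.suc (Fin.suc (Fin.suc Fin.zero))))))))))) = refl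

icosahedron : Graph 12
icosahedron = record
  { adj    = λ u v → icoE u v ∨ icoE v u
  ; sym    = λ u v → ∨-comm (icoE u v) (icoE v u)
  ; irrefl = icoIrrefl
  }

{-# OPTIONS --safe #-}
-- Since N(v) has neither a triangle nor three independent vertices, it has at most three vertices,
-- or is 2K₂ (v is then called a bowtie), or contains a spanning path on four vertices, or is C₅.
-- For x ∈ N(v) the set N(x) ∖ N[v] is a clique, hence has at most two vertices.  Counting the vertices
-- at distance two gives deg²(v) ≤ 9 unless v is a bowtie or N(v) = C₅; in the latter case deg²(v) ≤ 10,
-- and deg²(v) = 10 forces five distinct outer vertices, one above each edge of the pentagon (a wheel).
-- If v is not a bowtie then all its neighbours have deg² ≤ 11; if moreover they all have deg² ≥ 11
-- then they are bowties, and this forces N(v) to be a clique.  So a non-bowtie with deg² ≤ 9 gives (iii).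
-- If all vertices are bowties, every edge lies in exactly one triangle and every vertex in exactly two,
-- so G is the line graph of the cubic intersection graph of its triangles.  Otherwise there is a wheel;
-- neighbours of wheels are not bowties, so all vertices are wheels and G is the icosahedron.
module Submission where

open import Defs renaming (sym to adj-sym)
open import Data.Bool using (Bool; true; false; T; if_then_else_)
open import Data.Bool.Properties using (T?; T-∧; T-∨)
open import Data.Empty using (⊥; ⊥-elim)
open import Data.Fin using (Fin; zero; suc; toℕ; punchIn; _≟_)
open import Data.Fin.Patterns
open import Data.Fin.Properties using (any?; all?; toℕ-injective; punchIn-injective; ¬∀⟶∃¬)
open import Data.List using (List; []; _∷_; _++_; length; filter; map; concatMap; cartesianProduct; allFin)
open import Data.List.Membership.DecPropositional (_≟_ {12}) using () renaming (_∈?_ to _∈₁₂?_)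
open import Data.List.Membership.Propositional using (_∈_)
open import Data.List.Membership.Propositional.Properties using (∈-filter⁺; ∈-filter⁻; ∈-allFin; ∈-++⁺ˡ; ∈-++⁺ʳ; ∈-map⁺; ∈-map⁻; ∈-concatMap⁺; ∈-cartesianProduct⁺)
open import Data.List.Properties using (length-++)
open import Data.List.Relation.Unary.All as All using (All; []; _∷_)
open import Data.List.Relation.Unary.AllPairs using ([]; _∷_)
open import Data.List.Relation.Unary.Any as Any using (here; there; _─_; satisfied)
open import Data.List.Relation.Unary.Any.Properties using (any⁻)
open import Data.List.Relation.Unary.Unique.Propositional using (Unique)
open import Data.List.Relation.Unary.Unique.Propositional.Properties using (allFin⁺; filter⁺)
open import Data.Nat using (ℕ; suc; _≤_; _<_; _≤?_; z≤n; s≤s; _+_; _*_)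
open import Data.Nat.ListAction using (sum)
open import Data.Nat.Properties using (≤-antisym; ≤-trans; +-mono-≤; *-monoˡ-≤; m≤n⇒m≤1+n; <-cmp; <-irrefl; <-asym)
open import Data.Product using (Σ; ∃; ∃₂; _×_; _,_; proj₁; proj₂)
open import Data.Sum using (_⊎_; inj₁; inj₂; [_,_]′; swap)
open import Data.Vec using (Vec; lookup) renaming ([] to []ᵛ; _∷_ to _∷ᵛ_)
open import Data.Vec.Relation.Unary.All using () renaming (All to Allᵛ; [] to []ᵃ; _∷_ to _∷ᵃ_)
open import Data.Vec.Relation.Unary.AllPairs using () renaming ([] to []ᵖ; _∷_ to _∷ᵖ_)
open import Data.Vec.Relation.Unary.Unique.Propositional using () renaming (Unique to Uniqueᵛ)
open import Data.Vec.Relation.Unary.Unique.Propositional.Properties using (lookup-injective)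
open import Function using (_∘_; id; Equivalence)
open import Relation.Binary.Construct.Closure.ReflexiveTransitive using (Star; ε; _◅_)
open import Relation.Binary.Definitions using (Tri; tri<; tri≈; tri>)
open import Relation.Binary.PropositionalEquality using (_≡_; _≢_; refl; sym; trans; cong; cong₂; subst; ≢-sym)
open import Relation.Nullary using (¬_; Dec; yes; no; contradiction)
open import Relation.Nullary.Decidable using (_×-dec_; _⊎-dec_; _→-dec_; ¬?; map′; ⌊_⌋; toWitness; toWitnessFalse; fromWitness; fromWitnessFalse; decidable-stable; from-yes)
open import Relation.Unary using (Decidable)

private variable
  n : ℕ
  A : Set

-- Counting with lists and sizing decidable sets

∈-─ : {x y : A} {ys : List A} (x∈ys : x ∈ ys) → y ∈ ys → x ≢ y → y ∈ (ys ─ x∈ys)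
∈-─ (here refl)  (here refl)  x≢y = contradiction refl x≢y
∈-─ (here refl)  (there y∈ys) x≢y = y∈ys
∈-─ (there x∈ys) (here refl)  x≢y = here refl
∈-─ (there x∈ys) (there y∈ys) x≢y = there (∈-─ x∈ys y∈ys x≢y)

length-─ : {x : A} {ys : List A} (x∈ys : x ∈ ys) → length ys ≡ suc (length (ys ─ x∈ys))
length-─ (here refl)  = refl
length-─ (there x∈ys) = cong suc (length-─ x∈ys)

-- Pigeonhole: the head of `xs` is removed from `ys`, and the tail survives the removal because `xs`
-- has no repetition.
unique-⊆⇒length≤ : {xs ys : List A} → Unique xs → (∀ {x} → x ∈ xs → x ∈ ys) → length xs ≤ length ys
unique-⊆⇒length≤ []           _     = z≤n
unique-⊆⇒length≤ {xs = x ∷ xs} {ys} (x∉xs ∷ xs!) xs⊆ys = subst (suc (length xs) ≤_) (sym (length-─ x∈ys))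
  (s≤s (unique-⊆⇒length≤ xs! λ y∈xs → ∈-─ x∈ys (xs⊆ys (there y∈xs)) (All.lookup x∉xs y∈xs)))
  where x∈ys = xs⊆ys (here refl)

sum-indicator : (p : A → Bool) (xs : List A) →
  sum (map (λ x → if p x then 1 else 0) xs) ≡ length (filter (T? ∘ p) xs)
sum-indicator p []       = refl
sum-indicator p (x ∷ xs) with p x
... | true  = cong suc (sum-indicator p xs)
... | false = sum-indicator p xs

count-≤ : (p : Fin n → Bool) (xs : List (Fin n)) → (∀ u → T (p u) → u ∈ xs) → count p ≤ length xs
count-≤ {n} p xs cover = subst (_≤ length xs) (sym (sum-indicator p (allFin n)))
  (unique-⊆⇒length≤ (filter⁺ (T? ∘ p) (allFin⁺ n))
    λ {u} u∈ → cover u (proj₂ (∈-filter⁻ (T? ∘ p) {xs = allFin n} u∈)))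

≤-count : (p : Fin n → Bool) (xs : List (Fin n)) → Unique xs → All (T ∘ p) xs → length xs ≤ count p
≤-count {n} p xs xs! ps = subst (length xs ≤_) (sym (sum-indicator p (allFin n)))
  (unique-⊆⇒length≤ xs! λ u∈ → ∈-filter⁺ (T? ∘ p) (∈-allFin _) (All.lookup ps u∈))

count-≡ : (p : Fin n → Bool) (xs : List (Fin n)) → Unique xs → All (T ∘ p) xs →
  (∀ u → T (p u) → u ∈ xs) → count p ≡ length xs
count-≡ p xs xs! ps cover = ≤-antisym (count-≤ p xs cover) (≤-count p xs xs! ps)

-- Stops at three: for the sets measured here, three distinct members produce a claw or a K₄, so
-- `many` carries the witnesses of a contradiction.
data Size {n} (P : Fin n → Set) : Set where
  none : (∀ u → ¬ P u) → Size P
  one  : ∀ p → P p → (∀ u → P u → u ≡ p) → Size P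
  two  : ∀ p q → P p → P q → p ≢ q → (∀ u → P u → u ≡ p ⊎ u ≡ q) → Size P
  many : ∀ p q r → P p → P q → P r → p ≢ q → p ≢ r → q ≢ r → Size P

size : {P : Fin n → Set} → Decidable P → Size P
size {P = P} P? with any? P?
... | no ∄P = none λ u Pu → ∄P (u , Pu)
... | yes (p , Pp) with any? (λ u → P? u ×-dec ¬? (p ≟ u))
... | no ∄q = one p Pp eq
  where
  eq : ∀ u → P u → u ≡ p
  eq u Pu with p ≟ u
  ... | yes p≡u = sym p≡u
  ... | no  p≢u = contradiction (u , Pu , p≢u) ∄q
... | yes (q , Pq , p≢q) with any? (λ u → P? u ×-dec ¬? (p ≟ u) ×-dec ¬? (q ≟ u))
... | yes (r , Pr , p≢r , q≢r) = many p q r Pp Pq Pr p≢q p≢r q≢r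
... | no ∄r = two p q Pp Pq p≢q eq
  where
  eq : ∀ u → P u → u ≡ p ⊎ u ≡ q
  eq u Pu with p ≟ u | q ≟ u
  ... | yes p≡u | _       = inj₁ (sym p≡u)
  ... | no  _   | yes q≡u = inj₂ (sym q≡u)
  ... | no  p≢u | no  q≢u = contradiction (u , Pu , p≢u , q≢u) ∄r

pattern 1st = here refl
pattern 2nd = there 1st
pattern 3rd = there 2nd
pattern 4th = there 3rd
pattern 5th = there 4th

-- From the clique number to the exclusion of K₄

K₄-Free : ∀ {n} → Graph n → Set
K₄-Free G = ∀ {a b c d} → Adj G a b → Adj G a c → Adj G a d → Adj G b c → Adj G b d → Adj G c d → ⊥

ω≤3⇒K₄-free : ∀ {n} (G : Graph n) → (∀ m → HasClique G m → m ≤ 3) → K₄-Free G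
ω≤3⇒K₄-free {n} G ω≤3 {a} {b} {c} {d} ab ac ad bc bd cd with ω≤3 4 (f , inj , adjacent)
  where
  flip : ∀ {u w} → Adj G u w → Adj G w u
  flip {u} {w} = subst T (adj-sym G u w)
  f : Fin 4 → Fin n
  f zero                   = a
  f (suc zero)             = b
  f (suc (suc zero))       = c
  f (suc (suc (suc zero))) = d
  adjacent : ∀ i j → i ≢ j → Adj G (f i) (f j)
  adjacent zero zero i≢j = contradiction refl i≢j
  adjacent zero (suc zero) _ = ab
  adjacent zero (suc (suc zero)) _ = ac
  adjacent zero (suc (suc (suc zero))) _ = ad
  adjacent (suc zero) zero _ = flip ab
  adjacent (suc zero) (suc zero) i≢j = contradiction refl i≢j
  adjacent (suc zero) (suc (suc zero)) _ = bc
  adjacent (suc zero) (suc (suc (suc zero))) _ = bd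
  adjacent (suc (suc zero)) zero _ = flip ac
  adjacent (suc (suc zero)) (suc zero) _ = flip bc
  adjacent (suc (suc zero)) (suc (suc zero)) i≢j = contradiction refl i≢j
  adjacent (suc (suc zero)) (suc (suc (suc zero))) _ = cd
  adjacent (suc (suc (suc zero))) zero _ = flip ad
  adjacent (suc (suc (suc zero))) (suc zero) _ = flip bd
  adjacent (suc (suc (suc zero))) (suc (suc zero)) _ = flip cd
  adjacent (suc (suc (suc zero))) (suc (suc (suc zero))) i≢j = contradiction refl i≢j
  inj : ∀ {i j} → f i ≡ f j → i ≡ j
  inj {i} {j} fi≡fj with i ≟ j
  ... | yes i≡j = i≡j
  ... | no  i≢j = ⊥-elim (subst T (irrefl G (f j)) (subst (λ u → Adj G u (f j)) fi≡fj (adjacent i j i≢j)))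
... | s≤s (s≤s (s≤s ()))

-- Local consequences of excluding claws and K₄

module Local {n} (G : Graph n) (claw-free : ClawFree G) (k₄-free : K₄-Free G) where

  V : Set
  V = Fin n

  infix 4 _~_ _≁_ _~?_

  _~_ _≁_ : V → V → Set
  u ~ w = Adj G u w
  u ≁ w = ¬ u ~ w

  _~?_ : ∀ u w → Dec (u ~ w)
  u ~? w = T? (adj G u w)

  ~-sym : ∀ {u w} → u ~ w → w ~ u
  ~-sym {u} {w} = subst T (adj-sym G u w)

  ≁-sym : ∀ {u w} → u ≁ w → w ≁ u
  ≁-sym u≁w = u≁w ∘ ~-sym

  ~⇒≢ : ∀ {u w} → u ~ w → u ≢ w
  ~⇒≢ {u} u~u refl = subst T (irrefl G u) u~u

  separated : ∀ {u a b} → u ~ a → u ≁ b → a ≢ b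
  separated u~a u≁b refl = u≁b u~a

  -- The working form of claw-freeness: if `u` met neither `a` nor `b`, then `v` with leaves `a`,
  -- `b`, `u` would be a claw.
  fork : ∀ {v a b u} → v ~ a → v ~ b → a ≢ b → a ≁ b → v ~ u → u ≢ a → u ≢ b → u ~ a ⊎ u ~ b
  fork {v} {a} {b} {u} va vb a≢b a≁b vu u≢a u≢b with u ~? a | u ~? b
  ... | yes ua | _      = inj₁ ua
  ... | no _   | yes ub = inj₂ ub
  ... | no u≁a | no u≁b = contradiction (a≁b , ≁-sym u≁a , ≁-sym u≁b)
    (claw-free v a b u va vb vu a≢b (≢-sym u≢a) (≢-sym u≢b))

  Outside : V → V → Set
  Outside v u = v ≢ u × v ≁ u

  outside? : ∀ v u → Dec (Outside v u)
  outside? v u = ¬? (v ≟ u) ×-dec ¬? (v ~? u)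

  -- Here `v` is a leaf: non-adjacent `p` and `q` would form with it a claw centred at `w`.
  outside-clique : ∀ {v w p q} → v ~ w → Outside v p → w ~ p → Outside v q → w ~ q → p ≢ q → p ~ q
  outside-clique vw (v≢p , v≁p) wp (v≢q , v≁q) wq p≢q
    with fork (~-sym vw) wp v≢p v≁p wq (≢-sym v≢q) (≢-sym p≢q)
  ... | inj₁ qv = contradiction (~-sym qv) v≁q
  ... | inj₂ qp = ~-sym qp

  outside-cover : ∀ {v w} → v ~ w → ∃₂ λ p q → ∀ u → Outside v u → w ~ u → u ∈ p ∷ q ∷ []
  outside-cover {v} {w} vw with size (λ u → outside? v u ×-dec w ~? u)
  -- Missing entries are filled with a dummy, so that the list always has length two.
  ... | none ∄u                   = v , v , λ u vu wu → contradiction (vu , wu) (∄u u)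
  ... | one p _ eq                = p , p , λ u vu wu → here (eq u (vu , wu))
  ... | two p q _ _ _ eq          = p , q , λ u vu wu → [ here , there ∘ here ]′ (eq u (vu , wu))
  ... | many p q r (vp , wp) (vq , wq) (vr , wr) p≢q p≢r q≢r = ⊥-elim
    (k₄-free wp wq wr (outside-clique vw vp wp vq wq p≢q) (outside-clique vw vp wp vr wr p≢r)
      (outside-clique vw vq wq vr wr q≢r))

  -- Only the lengths of `xs` and `ys` enter, so both may contain repetitions and dummies. `far`
  -- receives a middle vertex `w`, so that it can be argued neighbour by neighbour.
  deg²-≤ : ∀ {v} xs ys → (∀ u → v ~ u → u ∈ xs) →
    (∀ u w → Outside v u → v ~ w → w ~ u → u ∈ ys) → deg² G v ≤ length (xs ++ ys)
  deg²-≤ {v} xs ys near far = count-≤ (sqAdj G v) (xs ++ ys) cover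
    where
    cover : ∀ u → T (sqAdj G v u) → u ∈ xs ++ ys
    cover u vu with Equivalence.to T-∧ vu
    ... | v≢u , vu with v ~? u
    ... | yes v~u = ∈-++⁺ˡ (near u v~u)
    ... | no  v≁u with Equivalence.to T-∨ vu
    ... | inj₁ v~u = contradiction v~u v≁u
    ... | inj₂ vwu with satisfied (any⁻ _ (allFin n) vwu)
    ... | w , vwu with Equivalence.to T-∧ vwu
    ... | vw , wu = ∈-++⁺ʳ xs (far u w (toWitnessFalse v≢u , v≁u) vw wu)

  -- Each listed vertex pays for itself and for the at most two vertices that it sees outside N[v].
  deg²-≤-3deg : ∀ {v} xs → (∀ u → v ~ u → u ∈ xs) → deg² G v ≤ length xs + length xs * 2
  deg²-≤-3deg {v} xs near = subst (deg² G v ≤_) (trans (length-++ xs) (cong (length xs +_) (length-pairs xs)))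
    (deg²-≤ xs (concatMap far xs) near λ u w vu vw wu → ∈-concatMap⁺ far (Any.map (λ { refl → far-cover w u vw vu wu }) (near w vw)))
    where
    far : V → List V
    far w with v ~? w
    ... | no _ = v ∷ v ∷ []
    ... | yes vw with outside-cover vw
    ... | p , q , _ = p ∷ q ∷ []
    far-cover : ∀ w u → v ~ w → Outside v u → w ~ u → u ∈ far w
    far-cover w u vw vu wu with v ~? w
    ... | no v≁w = contradiction vw v≁w
    ... | yes vw with outside-cover vw
    ... | p , q , cover = cover u vu wu
    length-pairs : ∀ ws → length (concatMap far ws) ≡ length ws * 2
    length-pairs [] = refl
    length-pairs (w ∷ ws) with v ~? w
    ... | no _ = cong (2 +_) (length-pairs ws)
    ... | yes vw with outside-cover vw
    ... | p , q , _ = cong (2 +_) (length-pairs ws)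

  -- For an edge `x y` inside N(v) this is an outer vertex above that edge: the apex of a triangle
  -- on the side away from `v`.
  Shared : V → V → V → V → Set
  Shared v x y u = Outside v u × x ~ u × y ~ u

  shared? : ∀ v x y u → Dec (Shared v x y u)
  shared? v x y u = outside? v u ×-dec x ~? u ×-dec y ~? u

  -- Two such vertices would be adjacent by `outside-clique` and form a K₄ with `x` and `y`.
  shared-unique : ∀ {v x y u w} → v ~ x → x ~ y → Shared v x y u → Shared v x y w → u ≡ w
  shared-unique {u = u} {w} vx xy (vu , xu , yu) (vw , xw , yw) with u ≟ w
  ... | yes u≡w = u≡w
  ... | no  u≢w = ⊥-elim (k₄-free xy xu xw yu yw (outside-clique vx vu xu vw xw u≢w))

  shared-cover : ∀ {v x y} → v ~ x → x ~ y → ∃ λ p → ∀ u → Shared v x y u → u ≡ p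
  shared-cover {v} {x} {y} vx xy with any? (shared? v x y)
  ... | yes (p , sp) = p , λ u su → shared-unique vx xy su sp
  ... | no  ∄u       = v , λ u su → contradiction (u , su) ∄u

  -- The fork at `x` between the non-adjacent `y` and `z` joins `u` to one of them. So what an inner
  -- vertex of a path in N(v) sees outside lies above an edge of the path.
  outside-middle : ∀ {v x y z u} → v ~ x → v ~ y → v ~ z → x ~ y → x ~ z → y ≢ z → y ≁ z →
    Outside v u → x ~ u → Shared v x y u ⊎ Shared v x z u
  outside-middle vx vy vz xy xz y≢z y≁z vu@(v≢u , v≁u) xu
    with fork xy xz y≢z y≁z xu (≢-sym (separated vy v≁u)) (≢-sym (separated vz v≁u))
  ... | inj₁ uy = inj₁ (vu , xu , ~-sym uy)
  ... | inj₂ uz = inj₂ (vu , xu , ~-sym uz)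

  shared-swap : ∀ {v x y u} → Shared v x y u → Shared v y x u
  shared-swap (vu , xu , yu) = vu , yu , xu

  -- The possible shapes of N(v)

  record Bowtie (v a b c d : V) : Set where
    field
      va    : v ~ a
      vb    : v ~ b
      vc    : v ~ c
      vd    : v ~ d
      ab    : a ~ b
      cd    : c ~ d
      a≁c   : a ≁ c
      a≁d   : a ≁ d
      b≁c   : b ≁ c
      b≁d   : b ≁ d
      cover : ∀ u → v ~ u → u ∈ a ∷ b ∷ c ∷ d ∷ []

  IsBowtie : V → Set
  IsBowtie v = ∃ λ a → ∃ λ b → ∃ λ c → ∃ λ d → Bowtie v a b c d

  -- x₁ ~ x₄ is allowed, so that this covers N(v) = C₄ as well as N(v) = P₄.
  record Path (v x₁ x₂ x₃ x₄ : V) : Set where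
    field
      v₁    : v ~ x₁
      v₂    : v ~ x₂
      v₃    : v ~ x₃
      v₄    : v ~ x₄
      e₁    : x₁ ~ x₂
      e₂    : x₂ ~ x₃
      e₃    : x₃ ~ x₄
      n₁    : x₁ ≁ x₃
      n₂    : x₂ ≁ x₄
      x₁≢x₃ : x₁ ≢ x₃
      x₂≢x₄ : x₂ ≢ x₄
      cover : ∀ u → v ~ u → u ∈ x₁ ∷ x₂ ∷ x₃ ∷ x₄ ∷ []

  -- Distinctness and coverage of N(v) are derived, in `pentagon-≢` and `pentagon-cover`. All
  -- indices are cyclic, so `rotate` merely shifts the fields.
  record Pentagon (v x₁ x₂ x₃ x₄ x₅ : V) : Set where
    field
      v₁ : v ~ x₁
      v₂ : v ~ x₂
      v₃ : v ~ x₃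
      v₄ : v ~ x₄
      v₅ : v ~ x₅
      e₁ : x₁ ~ x₂
      e₂ : x₂ ~ x₃
      e₃ : x₃ ~ x₄
      e₄ : x₄ ~ x₅
      e₅ : x₅ ~ x₁
      n₁ : x₁ ≁ x₃
      n₂ : x₂ ≁ x₄
      n₃ : x₃ ≁ x₅
      n₄ : x₄ ≁ x₁
      n₅ : x₅ ≁ x₂

  data Neighbourhood (v : V) : Set where
    few      : ∀ xs → length xs ≤ 3 → (∀ u → v ~ u → u ∈ xs) → Neighbourhood v
    bowtie   : ∀ {a b c d} → Bowtie v a b c d → Neighbourhood v
    path     : ∀ {x₁ x₂ x₃ x₄} → Path v x₁ x₂ x₃ x₄ → Neighbourhood v
    pentagon : ∀ {x₁ x₂ x₃ x₄ x₅} → Pentagon v x₁ x₂ x₃ x₄ x₅ → Neighbourhood v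

  -- Fix a neighbour `x` and split the others. Those adjacent to `x` are independent, as K₄ is
  -- excluded, so claw-freeness leaves at most two. Those not adjacent to `x` form a clique by
  -- claw-freeness at `v`, so excluding K₄ leaves at most two.
  neighbourhood : ∀ v → Neighbourhood v
  neighbourhood v with any? (v ~?_)
  ... | no ∄u = few [] z≤n λ u vu → contradiction (u , vu) ∄u
  ... | yes (x , vx) = split (size λ u → v ~? u ×-dec x ~? u)
                             (size λ u → v ~? u ×-dec ¬? (x ≟ u) ×-dec ¬? (x ~? u))
    where
    Near Far : V → Set
    Near u = v ~ u × x ~ u
    Far  u = v ~ u × Outside x u

    near-≁ : ∀ {p q} → Near p → Near q → p ≁ q
    near-≁ (vp , xp) (vq , xq) pq = k₄-free vx vp vq xp xq pq

    far-~ : ∀ {p q} → Far p → Far q → p ≢ q → p ~ q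
    far-~ (vp , xp) (vq , xq) = outside-clique (~-sym vx) xp vp xq vq

    near≢far : ∀ {p q} → Near p → Far q → q ≢ p
    near≢far (_ , xp) (_ , _ , x≁q) refl = x≁q xp

    covers : ∀ {as bs} → (∀ u → Near u → u ∈ as) → (∀ u → Far u → u ∈ bs) → ∀ u → v ~ u → u ∈ x ∷ as ++ bs
    covers {as} near far u vu with x ≟ u | x ~? u
    ... | yes refl | _      = here refl
    ... | no x≢u   | yes xu = there (∈-++⁺ˡ (near u (vu , xu)))
    ... | no x≢u   | no x≁u = there (∈-++⁺ʳ as (far u (vu , x≢u , x≁u)))

    split : Size Near → Size Far → Neighbourhood v
    split (many p q r p∈ q∈ r∈ p≢q p≢r q≢r) _ = contradiction (near-≁ p∈ q∈ , near-≁ p∈ r∈ , near-≁ q∈ r∈)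
      (claw-free v p q r (proj₁ p∈) (proj₁ q∈) (proj₁ r∈) p≢q p≢r q≢r)
    split _ (many p q r p∈ q∈ r∈ p≢q p≢r q≢r) = ⊥-elim
      (k₄-free (proj₁ p∈) (proj₁ q∈) (proj₁ r∈) (far-~ p∈ q∈ p≢q) (far-~ p∈ r∈ p≢r) (far-~ q∈ r∈ q≢r))
    split (none ∄a) (none ∄c) = few (x ∷ []) (s≤s z≤n)
      (covers {[]} {[]} (λ u u∈ → contradiction u∈ (∄a u)) (λ u u∈ → contradiction u∈ (∄c u)))
    split (none ∄a) (one c _ c!) = few (x ∷ c ∷ []) (s≤s (s≤s z≤n))
      (covers {[]} (λ u u∈ → contradiction u∈ (∄a u)) (λ u u∈ → here (c! u u∈)))
    split (none ∄a) (two c d _ _ _ cd!) = few (x ∷ c ∷ d ∷ []) (s≤s (s≤s (s≤s z≤n)))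
      (covers {[]} (λ u u∈ → contradiction u∈ (∄a u)) (λ u u∈ → [ here , there ∘ here ]′ (cd! u u∈)))
    split (one a _ a!) (none ∄c) = few (x ∷ a ∷ []) (s≤s (s≤s z≤n))
      (covers {_ ∷ []} {[]} (λ u u∈ → here (a! u u∈)) (λ u u∈ → contradiction u∈ (∄c u)))
    split (one a _ a!) (one c _ c!) = few (x ∷ a ∷ c ∷ []) (s≤s (s≤s (s≤s z≤n)))
      (covers {_ ∷ []} (λ u u∈ → here (a! u u∈)) (λ u u∈ → here (c! u u∈)))
    split (two a b _ _ _ ab!) (none ∄c) = few (x ∷ a ∷ b ∷ []) (s≤s (s≤s (s≤s z≤n)))
      (covers {_ ∷ _ ∷ []} {[]} (λ u u∈ → [ here , there ∘ here ]′ (ab! u u∈)) (λ u u∈ → contradiction u∈ (∄c u)))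
    -- An edge from `a` to `c` or `d` completes a path; without one, the triangles `v x a` and
    -- `v c d` form a bowtie.
    split (one a a∈@(va , xa) a!) (two c d c∈@(vc , x≢c , x≁c) d∈@(vd , x≢d , x≁d) c≢d cd!)
      with covers {_ ∷ []} (λ u u∈ → here (a! u u∈)) (λ u u∈ → [ here , there ∘ here ]′ (cd! u u∈))
         | a ~? c | a ~? d
    ... | cov | yes ac | _ = path record
      { v₁ = vx ; v₂ = va ; v₃ = vc ; v₄ = vd ; e₁ = xa ; e₂ = ac ; e₃ = far-~ c∈ d∈ c≢d
      ; n₁ = x≁c ; n₂ = λ ad → k₄-free va vc vd ac ad (far-~ c∈ d∈ c≢d)
      ; x₁≢x₃ = x≢c ; x₂≢x₄ = ≢-sym (near≢far a∈ d∈) ; cover = cov }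
    ... | cov | no a≁c | yes ad = path record
      { v₁ = vx ; v₂ = va ; v₃ = vd ; v₄ = vc ; e₁ = xa ; e₂ = ad ; e₃ = ~-sym (far-~ c∈ d∈ c≢d)
      ; n₁ = x≁d ; n₂ = a≁c ; x₁≢x₃ = x≢d ; x₂≢x₄ = ≢-sym (near≢far a∈ c∈)
      ; cover = λ u vu → swap₃₄ (cov u vu) }
      where
      swap₃₄ : ∀ {u p q r s : V} → u ∈ p ∷ q ∷ r ∷ s ∷ [] → u ∈ p ∷ q ∷ s ∷ r ∷ []
      swap₃₄ 1st = 1st
      swap₃₄ 2nd = 2nd
      swap₃₄ 3rd = 4th
      swap₃₄ 4th = 3rd
    ... | cov | no a≁c | no a≁d = bowtie record
      { va = vx ; vb = va ; vc = vc ; vd = vd ; ab = xa ; cd = far-~ c∈ d∈ c≢d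
      ; a≁c = x≁c ; a≁d = x≁d ; b≁c = a≁c ; b≁d = a≁d ; cover = cov }
    split (two a b a∈@(va , xa) b∈@(vb , xb) a≢b ab!) (one c c∈@(vc , x≢c , x≁c) c!)
      with covers {_ ∷ _ ∷ []} (λ u u∈ → [ here , there ∘ here ]′ (ab! u u∈)) (λ u u∈ → here (c! u u∈))
         | fork va vb a≢b (near-≁ a∈ b∈) vc (near≢far a∈ c∈) (near≢far b∈ c∈)
    ... | cov | inj₁ ca = path record
      { v₁ = vc ; v₂ = va ; v₃ = vx ; v₄ = vb ; e₁ = ca ; e₂ = ~-sym xa ; e₃ = xb
      ; n₁ = ≁-sym x≁c ; n₂ = near-≁ a∈ b∈ ; x₁≢x₃ = ≢-sym x≢c ; x₂≢x₄ = a≢b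
      ; cover = λ u vu → reorder (cov u vu) }
      where
      reorder : ∀ {u p q r s : V} → u ∈ p ∷ q ∷ r ∷ s ∷ [] → u ∈ s ∷ q ∷ p ∷ r ∷ []
      reorder 1st = 3rd
      reorder 2nd = 2nd
      reorder 3rd = 4th
      reorder 4th = 1st
    ... | cov | inj₂ cb = path record
      { v₁ = vc ; v₂ = vb ; v₃ = vx ; v₄ = va ; e₁ = cb ; e₂ = ~-sym xb ; e₃ = xa
      ; n₁ = ≁-sym x≁c ; n₂ = near-≁ b∈ a∈ ; x₁≢x₃ = ≢-sym x≢c ; x₂≢x₄ = ≢-sym a≢b
      ; cover = λ u vu → reorder (cov u vu) }
      where
      reorder : ∀ {u p q r s : V} → u ∈ p ∷ q ∷ r ∷ s ∷ [] → u ∈ s ∷ r ∷ p ∷ q ∷ []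
      reorder 1st = 3rd
      reorder 2nd = 4th
      reorder 3rd = 2nd
      reorder 4th = 1st
    -- `c` and `d` each meet `a` or `b`. Meeting the same one would give a K₄, so they meet
    -- different ones and close a pentagon with `x`.
    split (two a b a∈@(va , xa) b∈@(vb , xb) a≢b ab!) (two c d c∈@(vc , x≢c , x≁c) d∈@(vd , x≢d , x≁d) c≢d cd!)
      with far-~ c∈ d∈ c≢d
         | fork va vb a≢b (near-≁ a∈ b∈) vc (near≢far a∈ c∈) (near≢far b∈ c∈)
         | fork va vb a≢b (near-≁ a∈ b∈) vd (near≢far a∈ d∈) (near≢far b∈ d∈)
    ... | cd | inj₁ ca | inj₁ da = ⊥-elim (k₄-free va vc vd (~-sym ca) (~-sym da) cd)
    ... | cd | inj₂ cb | inj₂ db = ⊥-elim (k₄-free vb vc vd (~-sym cb) (~-sym db) cd)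
    ... | cd | inj₁ ca | inj₂ db = pentagon record
      { v₁ = vx ; v₂ = va ; v₃ = vc ; v₄ = vd ; v₅ = vb
      ; e₁ = xa ; e₂ = ~-sym ca ; e₃ = cd ; e₄ = db ; e₅ = ~-sym xb
      ; n₁ = x≁c ; n₂ = λ ad → k₄-free va vc vd (~-sym ca) ad cd
      ; n₃ = λ cb → k₄-free vb vc vd (~-sym cb) (~-sym db) cd
      ; n₄ = ≁-sym x≁d ; n₅ = near-≁ b∈ a∈ }
    ... | cd | inj₂ cb | inj₁ da = pentagon record
      { v₁ = vx ; v₂ = vb ; v₃ = vc ; v₄ = vd ; v₅ = va
      ; e₁ = xb ; e₂ = ~-sym cb ; e₃ = cd ; e₄ = da ; e₅ = ~-sym xa
      ; n₁ = x≁c ; n₂ = λ bd → k₄-free vb vc vd (~-sym cb) bd cd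
      ; n₃ = λ ca → k₄-free va vc vd (~-sym ca) (~-sym da) cd
      ; n₄ = ≁-sym x≁d ; n₅ = near-≁ a∈ b∈ }

-- Square degrees for small and path neighbourhoods

module Bounds {n} (G : Graph n) (claw-free : ClawFree G) (k₄-free : K₄-Free G) where
  open Local G claw-free k₄-free

  few-deg² : ∀ {v} xs → length xs ≤ 3 → (∀ u → v ~ u → u ∈ xs) → deg² G v ≤ 9
  few-deg² xs ∣xs∣≤3 near = ≤-trans (deg²-≤-3deg xs near) (+-mono-≤ ∣xs∣≤3 (*-monoˡ-≤ 2 ∣xs∣≤3))

  -- 4 + 5 vertices: two outer vertices for each end of the path and one above its middle edge. By
  -- `outside-middle`, whatever else the inner vertices see is seen from an end too.
  path-deg² : ∀ {v x₁ x₂ x₃ x₄} → Path v x₁ x₂ x₃ x₄ → deg² G v ≤ 9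
  path-deg² {v} {x₁} {x₂} {x₃} {x₄} P with outside-cover (Path.v₁ P) | outside-cover (Path.v₄ P) | shared-cover (Path.v₂ P) (Path.e₂ P)
  ... | p₁ , q₁ , c₁ | p₄ , q₄ , c₄ | s , c₂₃ = deg²-≤ (x₁ ∷ x₂ ∷ x₃ ∷ x₄ ∷ []) (s ∷ p₁ ∷ q₁ ∷ p₄ ∷ q₄ ∷ []) cover far
    where
    open Path P
    from₁ : ∀ {u} → Outside v u → x₁ ~ u → u ∈ s ∷ p₁ ∷ q₁ ∷ p₄ ∷ q₄ ∷ []
    from₁ vu x₁u = there (∈-++⁺ˡ (c₁ _ vu x₁u))
    from₄ : ∀ {u} → Outside v u → x₄ ~ u → u ∈ s ∷ p₁ ∷ q₁ ∷ p₄ ∷ q₄ ∷ []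
    from₄ vu x₄u = there (∈-++⁺ʳ (p₁ ∷ q₁ ∷ []) (c₄ _ vu x₄u))
    far : ∀ u w → Outside v u → v ~ w → w ~ u → u ∈ s ∷ p₁ ∷ q₁ ∷ p₄ ∷ q₄ ∷ []
    far u w vu vw wu with cover w vw
    ... | 1st = from₁ vu wu
    ... | 4th = from₄ vu wu
    ... | 2nd = [ (λ (_ , _ , x₁u) → from₁ vu x₁u) , (λ s₂₃ → here (c₂₃ u s₂₃)) ]′
      (outside-middle v₂ v₁ v₃ (~-sym e₁) e₂ x₁≢x₃ n₁ vu wu)
    ... | 3rd = [ (λ s₃₂ → here (c₂₃ u (shared-swap s₃₂))) , (λ (_ , _ , x₄u) → from₄ vu x₄u) ]′
      (outside-middle v₃ v₂ v₄ (~-sym e₂) e₃ x₂≢x₄ n₂ vu wu)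

  -- Bowties and their symmetries

  bowtie? : Decidable IsBowtie
  bowtie? v = any? λ a → any? λ b → any? λ c → any? λ d → map′
    (λ (va , vb , vc , vd , ab , cd , a≁c , a≁d , b≁c , b≁d , cover) → record
      { va = va ; vb = vb ; vc = vc ; vd = vd ; ab = ab ; cd = cd
      ; a≁c = a≁c ; a≁d = a≁d ; b≁c = b≁c ; b≁d = b≁d ; cover = cover })
    (λ B → let open Bowtie B in va , vb , vc , vd , ab , cd , a≁c , a≁d , b≁c , b≁d , cover)
    (v ~? a ×-dec v ~? b ×-dec v ~? c ×-dec v ~? d ×-dec a ~? b ×-dec c ~? d
      ×-dec ¬? (a ~? c) ×-dec ¬? (a ~? d) ×-dec ¬? (b ~? c) ×-dec ¬? (b ~? d)
      ×-dec all? λ u → v ~? u →-dec u ∈? (a ∷ b ∷ c ∷ d ∷ []))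
    where open import Data.List.Membership.DecPropositional (_≟_ {n}) using (_∈?_)

  bowtie-flip : ∀ {v a b c d} → Bowtie v a b c d → Bowtie v b a c d
  bowtie-flip B = record
    { va = vb ; vb = va ; vc = vc ; vd = vd ; ab = ~-sym ab ; cd = cd
    ; a≁c = b≁c ; a≁d = b≁d ; b≁c = a≁c ; b≁d = a≁d
    ; cover = λ u vu → reorder (cover u vu) }
    where
    open Bowtie B
    reorder : ∀ {u p q r s : V} → u ∈ p ∷ q ∷ r ∷ s ∷ [] → u ∈ q ∷ p ∷ r ∷ s ∷ []
    reorder 1st = 2nd
    reorder 2nd = 1st
    reorder 3rd = 3rd
    reorder 4th = 4th

  bowtie-swap : ∀ {v a b c d} → Bowtie v a b c d → Bowtie v c d a b
  bowtie-swap B = record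
    { va = vc ; vb = vd ; vc = va ; vd = vb ; ab = cd ; cd = ab
    ; a≁c = ≁-sym a≁c ; a≁d = ≁-sym b≁c ; b≁c = ≁-sym a≁d ; b≁d = ≁-sym b≁d
    ; cover = λ u vu → reorder (cover u vu) }
    where
    open Bowtie B
    reorder : ∀ {u p q r s : V} → u ∈ p ∷ q ∷ r ∷ s ∷ [] → u ∈ r ∷ s ∷ p ∷ q ∷ []
    reorder 1st = 3rd
    reorder 2nd = 4th
    reorder 3rd = 1st
    reorder 4th = 2nd

  bowtie-at : ∀ {v p} → IsBowtie v → v ~ p → ∃ λ b → ∃ λ c → ∃ λ d → Bowtie v p b c d
  bowtie-at (_ , _ , _ , _ , B) vp with Bowtie.cover B _ vp
  ... | 1st = _ , _ , _ , B
  ... | 2nd = _ , _ , _ , bowtie-flip B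
  ... | 3rd = _ , _ , _ , bowtie-swap B
  ... | 4th = _ , _ , _ , bowtie-flip (bowtie-swap B)

  bowtie-mate : ∀ {v a b c d q} → Bowtie v a b c d → v ~ q → a ~ q → q ≡ b
  bowtie-mate B vq aq with Bowtie.cover B _ vq
  ... | 1st = contradiction refl (~⇒≢ aq)
  ... | 2nd = refl
  ... | 3rd = contradiction aq (Bowtie.a≁c B)
  ... | 4th = contradiction aq (Bowtie.a≁d B)

  -- The obstruction to being a bowtie: no edge at a bowtie lies in two triangles.
  bowtie-unique : ∀ {v p q r} → IsBowtie v → v ~ p → v ~ q → v ~ r → p ~ q → p ~ r → q ≡ r
  bowtie-unique bt vp vq vr pq pr with bowtie-at bt vp
  ... | _ , _ , _ , B = trans (bowtie-mate B vq pq) (sym (bowtie-mate B vr pr))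

  -- Pentagonal neighbourhoods

  rotate : ∀ {v x₁ x₂ x₃ x₄ x₅} → Pentagon v x₁ x₂ x₃ x₄ x₅ → Pentagon v x₂ x₃ x₄ x₅ x₁
  rotate P = record
    { v₁ = v₂ ; v₂ = v₃ ; v₃ = v₄ ; v₄ = v₅ ; v₅ = v₁
    ; e₁ = e₂ ; e₂ = e₃ ; e₃ = e₄ ; e₄ = e₅ ; e₅ = e₁
    ; n₁ = n₂ ; n₂ = n₃ ; n₃ = n₄ ; n₄ = n₅ ; n₅ = n₁ }
    where open Pentagon P

  pentagon-≢ : ∀ {v x₁ x₂ x₃ x₄ x₅} → Pentagon v x₁ x₂ x₃ x₄ x₅ → x₁ ≢ x₃
  pentagon-≢ P = separated e₅ (≁-sym n₃)
    where open Pentagon P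

  -- R(3,3) = 6, seen from inside: a sixth neighbour would complete a K₄ or a claw.
  pentagon-cover : ∀ {v x₁ x₂ x₃ x₄ x₅} → Pentagon v x₁ x₂ x₃ x₄ x₅ →
    ∀ u → v ~ u → u ∈ x₁ ∷ x₂ ∷ x₃ ∷ x₄ ∷ x₅ ∷ []
  pentagon-cover {v} {x₁} {x₂} {x₃} {x₄} {x₅} P u vu with u ≟ x₁ | u ≟ x₂ | u ≟ x₃ | u ≟ x₄ | u ≟ x₅
  ... | yes refl | _ | _ | _ | _ = 1st
  ... | no _ | yes refl | _ | _ | _ = 2nd
  ... | no _ | no _ | yes refl | _ | _ = 3rd
  ... | no _ | no _ | no _ | yes refl | _ = 4th
  ... | no _ | no _ | no _ | no _ | yes refl = 5th
  ... | no u≢x₁ | no u≢x₂ | no u≢x₃ | no u≢x₄ | no u≢x₅ = ⊥-elim (sixth (u ~? x₁))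
    where
    open Pentagon P
    sixth : Dec (u ~ x₁) → ⊥
    sixth (yes ux₁) with fork v₅ v₂ (pentagon-≢ (rotate (rotate (rotate (rotate P))))) n₅ vu u≢x₅ u≢x₂
    ... | inj₁ ux₅ = k₄-free vu v₁ v₅ ux₁ ux₅ (~-sym e₅)
    ... | inj₂ ux₂ = k₄-free vu v₁ v₂ ux₁ ux₂ e₁
    sixth (no u≁x₁) with fork v₁ v₃ (pentagon-≢ P) n₁ vu u≢x₁ u≢x₃
                       | fork v₄ v₁ (pentagon-≢ (rotate (rotate (rotate P)))) n₄ vu u≢x₄ u≢x₁
    ... | inj₁ ux₁ | _        = u≁x₁ ux₁
    ... | inj₂ ux₃ | inj₂ ux₁ = u≁x₁ ux₁
    ... | inj₂ ux₃ | inj₁ ux₄ = k₄-free vu v₃ v₄ ux₃ ux₄ e₃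

  pentagon-elim : (Q : V → Set) {v : V} →
    (∀ {x₁ x₂ x₃ x₄ x₅} → Pentagon v x₁ x₂ x₃ x₄ x₅ → Q x₁) →
    ∀ {x₁ x₂ x₃ x₄ x₅} → Pentagon v x₁ x₂ x₃ x₄ x₅ → ∀ u → v ~ u → Q u
  pentagon-elim Q q P u vu with pentagon-cover P u vu
  ... | 1st = q P
  ... | 2nd = q (rotate P)
  ... | 3rd = q (rotate (rotate P))
  ... | 4th = q (rotate (rotate (rotate P)))
  ... | 5th = q (rotate (rotate (rotate (rotate P))))

  -- The edge from `v` to `x₁` lies in two triangles, with apexes `x₅` and `x₂`, which a bowtie at
  -- `x₁` forbids.
  pentagon-neighbour : ∀ {v x₁ x₂ x₃ x₄ x₅ w} → Pentagon v x₁ x₂ x₃ x₄ x₅ → v ~ w → ¬ IsBowtie w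
  pentagon-neighbour P vw = pentagon-elim (λ w → ¬ IsBowtie w)
    (λ P bt → let open Pentagon P in pentagon-≢ (rotate (rotate (rotate (rotate P))))
      (bowtie-unique bt (~-sym v₁) (~-sym e₅) e₁ v₅ v₂)) P _ vw

  pentagon-triangles : ∀ {v x₁ x₂ x₃ x₄ x₅ w} → Pentagon v x₁ x₂ x₃ x₄ x₅ → v ~ w →
    ∃₂ λ p q → p ≢ q × (v ~ p × w ~ p) × (v ~ q × w ~ q)
  pentagon-triangles P vw = pentagon-elim (λ w → ∃₂ λ p q → p ≢ q × (_ ~ p × w ~ p) × (_ ~ q × w ~ q))
    (λ P → let open Pentagon P in
      _ , _ , pentagon-≢ (rotate (rotate (rotate (rotate P)))) , (v₅ , ~-sym e₅) , (v₂ , e₁)) P _ vw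

  pentagon-outside : ∀ {v x₁ x₂ x₃ x₄ x₅ u} → Pentagon v x₁ x₂ x₃ x₄ x₅ → Outside v u → x₁ ~ u →
    Shared v x₁ x₂ u ⊎ Shared v x₅ x₁ u
  pentagon-outside P vu x₁u with outside-middle v₁ v₅ v₂ (~-sym e₅) e₁ (pentagon-≢ (rotate (rotate (rotate (rotate P))))) n₅ vu x₁u
    where open Pentagon P
  ... | inj₁ s₁₅ = inj₂ (shared-swap s₁₅)
  ... | inj₂ s₁₂ = inj₁ s₁₂

  -- By `pentagon-outside` and rotation, a vertex at distance two lies above one of the five edges.
  -- The continuation form lets each degree bound choose its own list.
  pentagon-far : ∀ {v x₁ x₂ x₃ x₄ x₅ u w} {Q : Set} → Pentagon v x₁ x₂ x₃ x₄ x₅ →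
    (Shared v x₁ x₂ u → Q) → (Shared v x₂ x₃ u → Q) → (Shared v x₃ x₄ u → Q) →
    (Shared v x₄ x₅ u → Q) → (Shared v x₅ x₁ u → Q) → Outside v u → v ~ w → w ~ u → Q
  pentagon-far P q₁ q₂ q₃ q₄ q₅ vu vw wu with pentagon-cover P _ vw
  ... | 1st = [ q₁ , q₅ ]′ (pentagon-outside P vu wu)
  ... | 2nd = [ q₂ , q₁ ]′ (pentagon-outside (rotate P) vu wu)
  ... | 3rd = [ q₃ , q₂ ]′ (pentagon-outside (rotate (rotate P)) vu wu)
  ... | 4th = [ q₄ , q₃ ]′ (pentagon-outside (rotate (rotate (rotate P))) vu wu)
  ... | 5th = [ q₅ , q₄ ]′ (pentagon-outside (rotate (rotate (rotate (rotate P)))) vu wu)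

  pentagon-deg² : ∀ {v x₁ x₂ x₃ x₄ x₅} → Pentagon v x₁ x₂ x₃ x₄ x₅ → deg² G v ≤ 10
  pentagon-deg² {v} {x₁} {x₂} {x₃} {x₄} {x₅} P
    with shared-cover v₁ e₁ | shared-cover v₂ e₂ | shared-cover v₃ e₃ | shared-cover v₄ e₄ | shared-cover v₅ e₅
    where open Pentagon P
  ... | s₁ , c₁ | s₂ , c₂ | s₃ , c₃ | s₄ , c₄ | s₅ , c₅ =
    deg²-≤ (x₁ ∷ x₂ ∷ x₃ ∷ x₄ ∷ x₅ ∷ []) (s₁ ∷ s₂ ∷ s₃ ∷ s₄ ∷ s₅ ∷ []) (pentagon-cover P)
      λ u w → pentagon-far P (λ s → here (c₁ u s)) (λ s → there (here (c₂ u s))) (λ s → there (there (here (c₃ u s))))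
        (λ s → there (there (there (here (c₄ u s))))) (λ s → there (there (there (there (here (c₅ u s))))))

  -- When the outer vertex above the first edge recurs above the second or third, four outer
  -- vertices suffice: 5 + 4.
  pentagon-deg²-redundant : ∀ {v x₁ x₂ x₃ x₄ x₅} → Pentagon v x₁ x₂ x₃ x₄ x₅ →
    (∀ u → Shared v x₁ x₂ u → Shared v x₂ x₃ u ⊎ Shared v x₃ x₄ u) → deg² G v ≤ 9
  pentagon-deg²-redundant {v} {x₁} {x₂} {x₃} {x₄} {x₅} P s₁⇒s₂⊎s₃
    with shared-cover v₂ e₂ | shared-cover v₃ e₃ | shared-cover v₄ e₄ | shared-cover v₅ e₅
    where open Pentagon P
  ... | s₂ , c₂ | s₃ , c₃ | s₄ , c₄ | s₅ , c₅ =
    deg²-≤ (x₁ ∷ x₂ ∷ x₃ ∷ x₄ ∷ x₅ ∷ []) (s₂ ∷ s₃ ∷ s₄ ∷ s₅ ∷ []) (pentagon-cover P)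
      λ u w → let q₂ = λ s → here (c₂ u s) ; q₃ = λ s → there (here (c₃ u s)) in
        pentagon-far P (λ s → [ q₂ , q₃ ]′ (s₁⇒s₂⊎s₃ u s)) q₂ q₃
          (λ s → there (there (here (c₄ u s)))) (λ s → there (there (there (here (c₅ u s)))))

  -- Wheels: pentagons with five distinct outer vertices

  Spoke : V → V → V → V → V → V → Set
  Spoke v x₁ x₂ x₃ x₄ a = Shared v x₁ x₂ a × ¬ Shared v x₂ x₃ a × ¬ Shared v x₃ x₄ a

  -- Comparing an edge with the next two is enough: over the five rotations this reaches all ten
  -- pairs of edges.
  pentagon-spoke : ∀ {v x₁ x₂ x₃ x₄ x₅} → Pentagon v x₁ x₂ x₃ x₄ x₅ → deg² G v ≤ 9 ⊎ ∃ (Spoke v x₁ x₂ x₃ x₄)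
  pentagon-spoke {v} {x₁} {x₂} {x₃} {x₄} P
    with any? (λ a → shared? v x₁ x₂ a ×-dec ¬? (shared? v x₂ x₃ a) ×-dec ¬? (shared? v x₃ x₄ a))
  ... | yes spoke = inj₂ spoke
  ... | no ∄spoke = inj₁ (pentagon-deg²-redundant P λ u s₁ →
    decidable-stable (shared? v x₂ x₃ u ⊎-dec shared? v x₃ x₄ u)
      λ ¬s → ∄spoke (u , s₁ , ¬s ∘ inj₁ , ¬s ∘ inj₂))

  -- The fields `p₁` to `p₅` separate outer vertices above consecutive edges, `q₁` to `q₅` those
  -- above edges two apart; the cyclic form suits `rotateʷ`.
  record Wheel (v x₁ x₂ x₃ x₄ x₅ a₁ a₂ a₃ a₄ a₅ : V) : Set where
    field
      hub : Pentagon v x₁ x₂ x₃ x₄ x₅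
      s₁  : Shared v x₁ x₂ a₁
      s₂  : Shared v x₂ x₃ a₂
      s₃  : Shared v x₃ x₄ a₃
      s₄  : Shared v x₄ x₅ a₄
      s₅  : Shared v x₅ x₁ a₅
      p₁  : a₁ ≢ a₂
      p₂  : a₂ ≢ a₃
      p₃  : a₃ ≢ a₄
      p₄  : a₄ ≢ a₅
      p₅  : a₅ ≢ a₁
      q₁  : a₁ ≢ a₃
      q₂  : a₂ ≢ a₄
      q₃  : a₃ ≢ a₅
      q₄  : a₄ ≢ a₁
      q₅  : a₅ ≢ a₂

  IsWheel : V → Set
  IsWheel v = ∃ λ x₁ → ∃ λ x₂ → ∃ λ x₃ → ∃ λ x₄ → ∃ λ x₅ → ∃ λ a₁ → ∃ λ a₂ → ∃ λ a₃ → ∃ λ a₄ → ∃ λ a₅ →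
    Wheel v x₁ x₂ x₃ x₄ x₅ a₁ a₂ a₃ a₄ a₅

  pentagon-wheel : ∀ {v x₁ x₂ x₃ x₄ x₅} → Pentagon v x₁ x₂ x₃ x₄ x₅ → deg² G v ≤ 9 ⊎ IsWheel v
  pentagon-wheel P
    with pentagon-spoke P | pentagon-spoke (rotate P) | pentagon-spoke (rotate (rotate P))
       | pentagon-spoke (rotate (rotate (rotate P))) | pentagon-spoke (rotate (rotate (rotate (rotate P))))
  ... | inj₁ ≤9 | _ | _ | _ | _ = inj₁ ≤9
  ... | inj₂ _ | inj₁ ≤9 | _ | _ | _ = inj₁ ≤9
  ... | inj₂ _ | inj₂ _ | inj₁ ≤9 | _ | _ = inj₁ ≤9
  ... | inj₂ _ | inj₂ _ | inj₂ _ | inj₁ ≤9 | _ = inj₁ ≤9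
  ... | inj₂ _ | inj₂ _ | inj₂ _ | inj₂ _ | inj₁ ≤9 = inj₁ ≤9
  ... | inj₂ (a₁ , s₁ , ¬s₁₂ , ¬s₁₃) | inj₂ (a₂ , s₂ , ¬s₂₃ , ¬s₂₄) | inj₂ (a₃ , s₃ , ¬s₃₄ , ¬s₃₅)
      | inj₂ (a₄ , s₄ , ¬s₄₅ , ¬s₄₁) | inj₂ (a₅ , s₅ , ¬s₅₁ , ¬s₅₂) =
    inj₂ (_ , _ , _ , _ , _ , a₁ , a₂ , a₃ , a₄ , a₅ , record
      { hub = P ; s₁ = s₁ ; s₂ = s₂ ; s₃ = s₃ ; s₄ = s₄ ; s₅ = s₅
      -- If two outer vertices coincided, one would lie above an edge that its spoke excludes.
      ; p₁ = λ { refl → ¬s₁₂ s₂ } ; p₂ = λ { refl → ¬s₂₃ s₃ } ; p₃ = λ { refl → ¬s₃₄ s₄ }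
      ; p₄ = λ { refl → ¬s₄₅ s₅ } ; p₅ = λ { refl → ¬s₅₁ s₁ }
      ; q₁ = λ { refl → ¬s₁₃ s₃ } ; q₂ = λ { refl → ¬s₂₄ s₄ } ; q₃ = λ { refl → ¬s₃₅ s₅ }
      ; q₄ = λ { refl → ¬s₄₁ s₁ } ; q₅ = λ { refl → ¬s₅₂ s₂ } })

  -- Vertices that are not bowties, and their neighbours

  classify : ∀ v → ¬ IsBowtie v → deg² G v ≤ 9 ⊎ IsWheel v
  classify v ¬bt with neighbourhood v
  ... | few xs ∣xs∣≤3 near = inj₁ (few-deg² xs ∣xs∣≤3 near)
  ... | bowtie B           = contradiction (_ , _ , _ , _ , B) ¬bt
  ... | path P             = inj₁ (path-deg² P)
  ... | pentagon P         = pentagon-wheel P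

  non-bowtie-deg² : ∀ {v} → ¬ IsBowtie v → deg² G v ≤ 10
  non-bowtie-deg² {v} ¬bt with classify v ¬bt
  ... | inj₁ ≤9 = m≤n⇒m≤1+n ≤9
  ... | inj₂ (_ , _ , _ , _ , _ , _ , _ , _ , _ , _ , W) = pentagon-deg² (Wheel.hub W)

  -- 4 + 7 vertices: `b`, `c` and `d` see at most two outside vertices each, and `a` adds at most
  -- `r` to these.
  bowtie-neighbour-deg² : ∀ {v a b c d} r → Bowtie v a b c d →
    (∀ u → Outside v u → a ~ u → u ≡ r ⊎ b ~ u) → deg² G v ≤ 11
  bowtie-neighbour-deg² {v} {a} {b} {c} {d} r B a-far
    with outside-cover (Bowtie.vb B) | outside-cover (Bowtie.vc B) | outside-cover (Bowtie.vd B)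
  ... | b₁ , b₂ , b-far | c₁ , c₂ , c-far | d₁ , d₂ , d-far =
    deg²-≤ (a ∷ b ∷ c ∷ d ∷ []) (r ∷ b₁ ∷ b₂ ∷ c₁ ∷ c₂ ∷ d₁ ∷ d₂ ∷ []) cover far
    where
    open Bowtie B
    far : ∀ u w → Outside v u → v ~ w → w ~ u → u ∈ r ∷ b₁ ∷ b₂ ∷ c₁ ∷ c₂ ∷ d₁ ∷ d₂ ∷ []
    far u w vu vw wu with cover w vw
    ... | 1st = [ here , (λ bu → there (∈-++⁺ˡ (b-far u vu bu))) ]′ (a-far u vu wu)
    ... | 2nd = there (∈-++⁺ˡ (b-far u vu wu))
    ... | 3rd = there (there (there (∈-++⁺ˡ (c-far u vu wu))))
    ... | 4th = there (there (there (there (there (d-far u vu wu)))))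

  -- If deg²(u) = 12 then the eight vertices at distance two are distinct, which makes each neighbour of u a bowtie.
  neighbour-deg² : ∀ {v u} → ¬ IsBowtie v → v ~ u → deg² G u ≤ 11
  neighbour-deg² {v} {u} ¬bt vu with bowtie? u
  ... | no ¬btu = m≤n⇒m≤1+n (non-bowtie-deg² ¬btu)
  ... | yes btu with bowtie-at btu (~-sym vu)
  ... | b , c , d , B with size (λ w → outside? u w ×-dec v ~? w)
  ... | none ∄w    = bowtie-neighbour-deg² v B λ w uw vw → contradiction (uw , vw) (∄w w)
  ... | one p _ p! = bowtie-neighbour-deg² p B λ w uw vw → inj₁ (p! w (uw , vw))
  ... | many p q r (up , vp) (uq , vq) (ur , vr) p≢q p≢r q≢r = ⊥-elim
    (k₄-free vp vq vr (outside-clique (~-sym vu) up vp uq vq p≢q) (outside-clique (~-sym vu) up vp ur vr p≢r)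
      (outside-clique (~-sym vu) uq vq ur vr q≢r))
  ... | two p q (up , vp) (uq , vq) p≢q pq! with b ~? p | b ~? q
  ... | yes bp | _      = bowtie-neighbour-deg² q B λ w uw vw → [ (λ { refl → inj₂ bp }) , inj₁ ]′ (pq! w (uw , vw))
  ... | no _   | yes bq = bowtie-neighbour-deg² p B λ w uw vw → [ inj₁ , (λ { refl → inj₂ bq }) ]′ (pq! w (uw , vw))
  ... | no b≁p | no b≁q = contradiction (u , b , p , q , record
      { va = vu ; vb = ab ; vc = vp ; vd = vq ; ab = vb ; cd = outside-clique (~-sym vu) up vp uq vq p≢q
      ; a≁c = proj₂ up ; a≁d = proj₂ uq ; b≁c = b≁p ; b≁d = b≁q ; cover = v-cover }) ¬bt
    where
    open Bowtie B
    v-cover : ∀ w → v ~ w → w ∈ u ∷ b ∷ p ∷ q ∷ []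
    v-cover w vw with u ≟ w | u ~? w
    ... | yes refl | _      = 1st
    ... | no u≢w   | no u≁w = [ (λ w≡p → there (there (here w≡p))) , (λ w≡q → there (there (there (here w≡q)))) ]′
      (pq! w ((u≢w , u≁w) , vw))
    ... | no _     | yes uw with cover w uw
    ... | 1st = contradiction refl (~⇒≢ vw)
    ... | 2nd = 2nd
    ... | 3rd = contradiction vw a≁c
    ... | 4th = contradiction vw a≁d

  -- If `x` and `y` were not adjacent, let `x′` and `y′` complete triangles over `v x` and `v y`. By
  -- `fork` every further neighbour of `v` meets `x` or `y`, hence is `x′` or `y′`. An edge between
  -- the pairs would contradict `bowtie-unique`, so `v` would be a bowtie.
  bowtie-neighbours⇒clique : ∀ {v} → ¬ IsBowtie v → (∀ u → v ~ u → IsBowtie u) →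
    ∀ {x y} → v ~ x → v ~ y → x ≢ y → x ~ y
  bowtie-neighbours⇒clique {v} ¬bt bts {x} {y} vx vy x≢y = decidable-stable (x ~? y) absurd
    where
    absurd : ¬ x ≁ y
    absurd x≁y with bowtie-at (bts x vx) (~-sym vx) | bowtie-at (bts y vy) (~-sym vy)
    ... | x′ , _ , _ , X | y′ , _ , _ , Y = ¬bt (x , x′ , y , y′ , record
      { va = vx ; vb = vx′ ; vc = vy ; vd = vy′ ; ab = xx′ ; cd = yy′ ; a≁c = x≁y
      ; a≁d = λ xy′ → x≢y (bowtie-unique (bts y′ vy′) (~-sym vy′) (~-sym xy′) (~-sym yy′) vx vy)
      ; b≁c = λ x′y → x≢y (bowtie-unique (bts x′ vx′) (~-sym vx′) (~-sym xx′) x′y vx vy)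
      ; b≁d = λ x′y′ → x≁y (~-sym (subst (y ~_)
          (sym (bowtie-unique (bts x′ vx′) (~-sym vx′) (~-sym xx′) x′y′ vx vy′)) yy′))
      ; cover = cover })
      where
      vx′ = Bowtie.ab X
      vy′ = Bowtie.ab Y
      xx′ = Bowtie.vb X
      yy′ = Bowtie.vb Y
      cover : ∀ u → v ~ u → u ∈ x ∷ x′ ∷ y ∷ y′ ∷ []
      cover u vu with u ≟ x | u ≟ y
      ... | yes refl | _        = 1st
      ... | no _     | yes refl = 3rd
      ... | no u≢x   | no u≢y with fork vx vy x≢y x≁y vu u≢x u≢y
      ... | inj₁ ux = there (here (bowtie-mate X (~-sym ux) vu))
      ... | inj₂ uy = there (there (there (here (bowtie-mate Y (~-sym uy) vu))))

-- Closing a wheel up to an icosahedron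

module Icosahedral {n} (G : Graph n) (claw-free : ClawFree G) (k₄-free : K₄-Free G) where
  open Local G claw-free k₄-free
  open Bounds G claw-free k₄-free

  rotateʷ : ∀ {v x₁ x₂ x₃ x₄ x₅ a₁ a₂ a₃ a₄ a₅} → Wheel v x₁ x₂ x₃ x₄ x₅ a₁ a₂ a₃ a₄ a₅ →
    Wheel v x₂ x₃ x₄ x₅ x₁ a₂ a₃ a₄ a₅ a₁
  rotateʷ W = record
    { hub = rotate hub
    ; s₁ = s₂ ; s₂ = s₃ ; s₃ = s₄ ; s₄ = s₅ ; s₅ = s₁
    ; p₁ = p₂ ; p₂ = p₃ ; p₃ = p₄ ; p₄ = p₅ ; p₅ = p₁
    ; q₁ = q₂ ; q₂ = q₃ ; q₃ = q₄ ; q₄ = q₅ ; q₅ = q₁ }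
    where open Wheel W

  module _ {v x₁ x₂ x₃ x₄ x₅ a₁ a₂ a₃ a₄ a₅} (W : Wheel v x₁ x₂ x₃ x₄ x₅ a₁ a₂ a₃ a₄ a₅) where
    open Wheel W
    open Pentagon hub

    rim : a₁ ~ a₂
    rim with s₁ | s₂
    ... | o₁ , _ , x₂a₁ | o₂ , x₂a₂ , _ = outside-clique v₂ o₁ x₂a₁ o₂ x₂a₂ p₁

    x₁-outside : ∀ {u} → Outside v u → x₁ ~ u → u ≡ a₁ ⊎ u ≡ a₅
    x₁-outside vu x₁u with pentagon-outside hub vu x₁u
    ... | inj₁ s = inj₁ (shared-unique v₁ e₁ s s₁)
    ... | inj₂ s = inj₂ (shared-unique v₅ e₅ s s₅)

    x₁≁a₂ : x₁ ≁ a₂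
    x₁≁a₂ x₁a₂ = [ ≢-sym p₁ , ≢-sym q₅ ]′ (x₁-outside (proj₁ s₂) x₁a₂)

    x₁≁a₄ : x₁ ≁ a₄
    x₁≁a₄ x₁a₄ = [ q₄ , p₄ ]′ (x₁-outside (proj₁ s₄) x₁a₄)

  module _ {v x₁ x₂ x₃ x₄ x₅ a₁ a₂ a₃ a₄ a₅} (W : Wheel v x₁ x₂ x₃ x₄ x₅ a₁ a₂ a₃ a₄ a₅) where
    open Wheel W
    open Pentagon hub
    private
      W₂ = rotateʷ W
      W₃ = rotateʷ W₂
      W₄ = rotateʷ W₃
      W₅ = rotateʷ W₄

    x₁-link : Pentagon x₁ v x₂ a₁ a₅ x₅
    x₁-link with s₁ | s₅
    ... | (_ , v≁a₁) , x₁a₁ , x₂a₁ | (_ , v≁a₅) , x₅a₅ , x₁a₅ = record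
      { v₁ = ~-sym v₁ ; v₂ = e₁ ; v₃ = x₁a₁ ; v₄ = x₁a₅ ; v₅ = ~-sym e₅
      ; e₁ = v₂ ; e₂ = x₂a₁ ; e₃ = ~-sym (rim W₅) ; e₄ = ~-sym x₅a₅ ; e₅ = ~-sym v₅
      ; n₁ = v≁a₁ ; n₂ = x₁≁a₄ W₂ ; n₃ = ≁-sym (x₁≁a₂ W₅) ; n₄ = ≁-sym v≁a₅ ; n₅ = n₅ }

    -- Suppose `a₁ ~ a₃`. The fork at `a₃` between `x₃` and `a₄` forces `a₁ ~ a₄`, as `x₃` misses
    -- `a₁`. Then `a₂` misses `a₄`, or a K₄ arises, and the fork at `a₁` between `a₂` and `a₄` would
    -- join `x₁` to one of them.
    rim-chordless : a₁ ≁ a₃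
    rim-chordless a₁a₃ with s₃
    ... | _ , x₃a₃ , _ with fork (~-sym x₃a₃) (rim W₃) (separated v₃ (proj₂ (proj₁ s₄))) (x₁≁a₂ W₃) (~-sym a₁a₃)
                              (≢-sym (separated v₃ (proj₂ (proj₁ s₁)))) (≢-sym q₄)
    ... | inj₁ a₁x₃ = x₁≁a₄ W₃ (~-sym a₁x₃)
    ... | inj₂ a₁a₄ with fork (rim W) a₁a₄ q₂ (λ a₂a₄ → k₄-free (rim W) a₁a₃ a₁a₄ (rim W₂) a₂a₄ (rim W₃))
                           (~-sym (proj₁ (proj₂ s₁))) (separated v₁ (proj₂ (proj₁ s₂))) (separated v₁ (proj₂ (proj₁ s₄)))
    ... | inj₁ x₁a₂ = x₁≁a₂ W x₁a₂
    ... | inj₂ x₁a₄ = x₁≁a₄ W x₁a₄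

  module _ {v x₁ x₂ x₃ x₄ x₅ a₁ a₂ a₃ a₄ a₅} (W : Wheel v x₁ x₂ x₃ x₄ x₅ a₁ a₂ a₃ a₄ a₅) where
    open Wheel W
    open Pentagon hub
    private
      W₂ = rotateʷ W
      W₃ = rotateʷ W₂

    x₂≁apex : ∀ {b} → b ~ a₁ → b ~ a₂ → x₂ ≁ b
    x₂≁apex ba₁ ba₂ x₂b = k₄-free (rim W) (~-sym (proj₂ (proj₂ s₁))) (~-sym ba₁)
      (~-sym (proj₁ (proj₂ s₂))) (~-sym ba₂) x₂b

    -- `b` misses `x₂`, so the fork at `a₂` between `x₂` and `a₃` joins it to `a₃`. Returning
    -- `b ≢ x₃` as well lets the step be repeated around the rim.
    apex-next : ∀ {b} → b ~ a₁ → b ~ a₂ → b ≢ x₂ → b ~ a₃ × b ≢ x₃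
    apex-next ba₁ ba₂ b≢x₂ with fork (~-sym (proj₁ (proj₂ s₂))) (rim W₂) (separated v₂ (proj₂ (proj₁ s₃))) (x₁≁a₂ W₂)
                                  (~-sym ba₂) b≢x₂ (λ { refl → rim-chordless W (~-sym ba₁) })
    ... | inj₁ bx₂ = contradiction (~-sym bx₂) (x₂≁apex ba₁ ba₂)
    ... | inj₂ ba₃ = ba₃ , λ { refl → x₁≁a₄ W₃ ba₁ }

    -- A pentagon around `a₁` puts the edge `a₁ a₂` into two triangles; at most one has apex `x₂`,
    -- and the other supplies the twelfth vertex.
    apex-exists : ∀ {y₁ y₂ y₃ y₄ y₅} → Pentagon a₁ y₁ y₂ y₃ y₄ y₅ → ∃ λ b → b ~ a₁ × b ~ a₂ × b ≢ x₂
    apex-exists Y with pentagon-triangles Y (rim W)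
    ... | p , q , p≢q , (a₁p , a₂p) , (a₁q , a₂q) with p ≟ x₂
    ... | no p≢x₂  = p , ~-sym a₁p , ~-sym a₂p , p≢x₂
    ... | yes refl = q , ~-sym a₁q , ~-sym a₂q , ≢-sym p≢q

  record Icosa (v x₁ x₂ x₃ x₄ x₅ a₁ a₂ a₃ a₄ a₅ b : V) : Set where
    field
      wheel : Wheel v x₁ x₂ x₃ x₄ x₅ a₁ a₂ a₃ a₄ a₅
      b₁    : b ~ a₁
      b₂    : b ~ a₂
      b₃    : b ~ a₃
      b₄    : b ~ a₄
      b₅    : b ~ a₅

  wheel⇒icosa : (∀ u → IsWheel u) → ∀ {v x₁ x₂ x₃ x₄ x₅ a₁ a₂ a₃ a₄ a₅} → Wheel v x₁ x₂ x₃ x₄ x₅ a₁ a₂ a₃ a₄ a₅ →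
    ∃ (Icosa v x₁ x₂ x₃ x₄ x₅ a₁ a₂ a₃ a₄ a₅)
  wheel⇒icosa wheels {a₁ = a₁} W with wheels a₁
  ... | _ , _ , _ , _ , _ , _ , _ , _ , _ , _ , W₁ with apex-exists W (Wheel.hub W₁)
  ... | b , b₁ , b₂ , b≢x₂ with apex-next W b₁ b₂ b≢x₂
  ... | b₃ , b≢x₃ with apex-next (rotateʷ W) b₂ b₃ b≢x₃
  ... | b₄ , b≢x₄ with apex-next (rotateʷ (rotateʷ W)) b₃ b₄ b≢x₄
  ... | b₅ , _ = b , record { wheel = W ; b₁ = b₁ ; b₂ = b₂ ; b₃ = b₃ ; b₄ = b₄ ; b₅ = b₅ }

  rotateⁱ : ∀ {v x₁ x₂ x₃ x₄ x₅ a₁ a₂ a₃ a₄ a₅ b} → Icosa v x₁ x₂ x₃ x₄ x₅ a₁ a₂ a₃ a₄ a₅ b →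
    Icosa v x₂ x₃ x₄ x₅ x₁ a₂ a₃ a₄ a₅ a₁ b
  rotateⁱ I = record { wheel = rotateʷ wheel ; b₁ = b₂ ; b₂ = b₃ ; b₃ = b₄ ; b₄ = b₅ ; b₅ = b₁ }
    where open Icosa I

  a₁-link : ∀ {v x₁ x₂ x₃ x₄ x₅ a₁ a₂ a₃ a₄ a₅ b} → Icosa v x₁ x₂ x₃ x₄ x₅ a₁ a₂ a₃ a₄ a₅ b →
    Pentagon a₁ x₁ x₂ a₂ b a₅
  a₁-link I with Wheel.s₁ (Icosa.wheel I) | Wheel.s₂ (Icosa.wheel I) | Wheel.s₅ (Icosa.wheel I)
  ... | _ , x₁a₁ , x₂a₁ | _ , x₂a₂ , _ | _ , _ , x₁a₅ = record
    { v₁ = ~-sym x₁a₁ ; v₂ = ~-sym x₂a₁ ; v₃ = rim W ; v₄ = ~-sym b₁ ; v₅ = ~-sym (rim W₅)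
    ; e₁ = Pentagon.e₁ (Wheel.hub W) ; e₂ = x₂a₂ ; e₃ = ~-sym b₂ ; e₄ = b₅ ; e₅ = ~-sym x₁a₅
    ; n₁ = x₁≁a₂ W ; n₂ = x₂≁apex W b₁ b₂ ; n₃ = ≁-sym (rim-chordless W₅)
    ; n₄ = ≁-sym (x₂≁apex W₅ b₅ b₁) ; n₅ = ≁-sym (x₁≁a₄ (rotateʷ W)) }
    where
    open Icosa I renaming (wheel to W)
    W₅ = rotateʷ (rotateʷ (rotateʷ (rotateʷ W)))

  b-link : ∀ {v x₁ x₂ x₃ x₄ x₅ a₁ a₂ a₃ a₄ a₅ b} → Icosa v x₁ x₂ x₃ x₄ x₅ a₁ a₂ a₃ a₄ a₅ b →
    Pentagon b a₁ a₂ a₃ a₄ a₅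
  b-link I = record
    { v₁ = b₁ ; v₂ = b₂ ; v₃ = b₃ ; v₄ = b₄ ; v₅ = b₅
    ; e₁ = rim W ; e₂ = rim W₂ ; e₃ = rim W₃ ; e₄ = rim W₄ ; e₅ = rim W₅
    ; n₁ = rim-chordless W ; n₂ = rim-chordless W₂ ; n₃ = rim-chordless W₃ ; n₄ = rim-chordless W₄
    ; n₅ = rim-chordless W₅ }
    where
    open Icosa I renaming (wheel to W)
    W₂ = rotateʷ W
    W₃ = rotateʷ W₂
    W₄ = rotateʷ W₃
    W₅ = rotateʷ W₄

-- The isomorphism with the icosahedron

ico-neighbours : Fin 12 → List (Fin 12)
ico-neighbours 0F                   = 1F ∷ 2F ∷ 3F ∷ 4F ∷ 5F ∷ []
ico-neighbours 1F                   = 0F ∷ 2F ∷ 7F ∷ 6F ∷ 5F ∷ []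
ico-neighbours 2F                   = 0F ∷ 3F ∷ 8F ∷ 7F ∷ 1F ∷ []
ico-neighbours 3F                   = 0F ∷ 4F ∷ 9F ∷ 8F ∷ 2F ∷ []
ico-neighbours 4F                   = 0F ∷ 5F ∷ suc 9F ∷ 9F ∷ 3F ∷ []
ico-neighbours 5F                   = 0F ∷ 1F ∷ 6F ∷ suc 9F ∷ 4F ∷ []
ico-neighbours 6F                   = 5F ∷ 1F ∷ 7F ∷ suc (suc 9F) ∷ suc 9F ∷ []
ico-neighbours 7F                   = 1F ∷ 2F ∷ 8F ∷ suc (suc 9F) ∷ 6F ∷ []
ico-neighbours 8F                   = 2F ∷ 3F ∷ 9F ∷ suc (suc 9F) ∷ 7F ∷ []
ico-neighbours 9F                   = 3F ∷ 4F ∷ suc 9F ∷ suc (suc 9F) ∷ 8F ∷ []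
ico-neighbours (suc 9F)             = 4F ∷ 5F ∷ 6F ∷ suc (suc 9F) ∷ 9F ∷ []
ico-neighbours (suc (suc 9F))       = 7F ∷ 8F ∷ 9F ∷ suc 9F ∷ 6F ∷ []

ico-neighbours-complete : ∀ i j → Adj icosahedron i j → j ∈ ico-neighbours i
ico-neighbours-complete = from-yes (all? λ i → all? λ j → T? (adj icosahedron i j) →-dec j ∈₁₂? ico-neighbours i)

ico-neighbours-sound : ∀ i j → j ∈ ico-neighbours i → Adj icosahedron i j
ico-neighbours-sound = from-yes (all? λ i → all? λ j → j ∈₁₂? ico-neighbours i →-dec T? (adj icosahedron i j))

T-injective : ∀ {p q} → (T p → T q) → (T q → T p) → p ≡ q
T-injective {false} {false} _ _ = refl
T-injective {false} {true}  _ g = ⊥-elim (g _)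
T-injective {true}  {false} f _ = ⊥-elim (f _)
T-injective {true}  {true}  _ _ = refl

module Isomorphism {n} (G : Graph n) (claw-free : ClawFree G) (k₄-free : K₄-Free G) where
  open Local G claw-free k₄-free
  open Bounds G claw-free k₄-free
  open Icosahedral G claw-free k₄-free

  module _ {v x₁ x₂ x₃ x₄ x₅ a₁ a₂ a₃ a₄ a₅ b} (I : Icosa v x₁ x₂ x₃ x₄ x₅ a₁ a₂ a₃ a₄ a₅ b) (connected : Connected G) where
    private
      I₂ = rotateⁱ I
      I₃ = rotateⁱ I₂
      I₄ = rotateⁱ I₃
      I₅ = rotateⁱ I₄
    open Icosa
    open Wheel (wheel I)
    open Pentagon hub

    vertices : Vec V 12
    -- `a₅` precedes `a₁` because vertex 6 of `icosahedron` is the one above the edge from 5 to 1.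
    vertices = v ∷ᵛ x₁ ∷ᵛ x₂ ∷ᵛ x₃ ∷ᵛ x₄ ∷ᵛ x₅ ∷ᵛ a₅ ∷ᵛ a₁ ∷ᵛ a₂ ∷ᵛ a₃ ∷ᵛ a₄ ∷ᵛ b ∷ᵛ []ᵛ

    g : Fin 12 → V
    g = lookup vertices

    -- The index ties the pentagon around `g i` to `ico-neighbours i`, written in the same cyclic
    -- order, so that all twelve vertices are treated alike.
    data Link (u : V) : List V → Set where
      link : ∀ {y₁ y₂ y₃ y₄ y₅} → Pentagon u y₁ y₂ y₃ y₄ y₅ → Link u (y₁ ∷ y₂ ∷ y₃ ∷ y₄ ∷ y₅ ∷ [])

    links : ∀ i → Link (g i) (map g (ico-neighbours i))
    links 0F             = link hub
    links 1F             = link (x₁-link (wheel I))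
    links 2F             = link (x₁-link (wheel I₂))
    links 3F             = link (x₁-link (wheel I₃))
    links 4F             = link (x₁-link (wheel I₄))
    links 5F             = link (x₁-link (wheel I₅))
    links 6F             = link (a₁-link I₅)
    links 7F             = link (a₁-link I)
    links 8F             = link (a₁-link I₂)
    links 9F             = link (a₁-link I₃)
    links (suc 9F)       = link (a₁-link I₄)
    links (suc (suc 9F)) = link (b-link I)

    link-cover : ∀ {u ys w} → Link u ys → u ~ w → w ∈ ys
    link-cover (link P) = pentagon-cover P _

    link-adjacent : ∀ {u ys w} → Link u ys → w ∈ ys → u ~ w
    link-adjacent (link P) 1st = Pentagon.v₁ P
    link-adjacent (link P) 2nd = Pentagon.v₂ P
    link-adjacent (link P) 3rd = Pentagon.v₃ P
    link-adjacent (link P) 4th = Pentagon.v₄ P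
    link-adjacent (link P) 5th = Pentagon.v₅ P

    v≁b : v ≁ b
    v≁b vb with pentagon-cover (b-link I) v (~-sym vb)
    ... | 1st = proj₁ (proj₁ s₁) refl
    ... | 2nd = proj₁ (proj₁ s₂) refl
    ... | 3rd = proj₁ (proj₁ s₃) refl
    ... | 4th = proj₁ (proj₁ s₄) refl
    ... | 5th = proj₁ (proj₁ s₅) refl

    vertices-unique : Uniqueᵛ vertices
    vertices-unique =
      (~⇒≢ v₁ ∷ᵃ ~⇒≢ v₂ ∷ᵃ ~⇒≢ v₃ ∷ᵃ ~⇒≢ v₄ ∷ᵃ ~⇒≢ v₅
        ∷ᵃ proj₁ (proj₁ s₅) ∷ᵃ proj₁ (proj₁ s₁) ∷ᵃ proj₁ (proj₁ s₂) ∷ᵃ proj₁ (proj₁ s₃) ∷ᵃ proj₁ (proj₁ s₄)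
        ∷ᵃ (λ { refl → proj₂ (proj₁ s₁) (b₁ I) }) ∷ᵃ []ᵃ) ∷ᵖ
      (~⇒≢ e₁ ∷ᵃ pentagon-≢ hub ∷ᵃ ≢-sym (pentagon-≢ (hub₄)) ∷ᵃ ≢-sym (~⇒≢ e₅) ∷ᵃ x≢ v₁) ∷ᵖ
      (~⇒≢ e₂ ∷ᵃ pentagon-≢ hub₂ ∷ᵃ ≢-sym (pentagon-≢ hub₅) ∷ᵃ x≢ v₂) ∷ᵖ
      (~⇒≢ e₃ ∷ᵃ pentagon-≢ hub₃ ∷ᵃ x≢ v₃) ∷ᵖ
      (~⇒≢ e₄ ∷ᵃ x≢ v₄) ∷ᵖ
      x≢ v₅ ∷ᵖ
      (p₅ ∷ᵃ q₅ ∷ᵃ ≢-sym q₃ ∷ᵃ ≢-sym p₄ ∷ᵃ ≢-sym (~⇒≢ (b₅ I)) ∷ᵃ []ᵃ) ∷ᵖ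
      (p₁ ∷ᵃ q₁ ∷ᵃ ≢-sym q₄ ∷ᵃ ≢-sym (~⇒≢ (b₁ I)) ∷ᵃ []ᵃ) ∷ᵖ
      (p₂ ∷ᵃ q₂ ∷ᵃ ≢-sym (~⇒≢ (b₂ I)) ∷ᵃ []ᵃ) ∷ᵖ
      (p₃ ∷ᵃ ≢-sym (~⇒≢ (b₃ I)) ∷ᵃ []ᵃ) ∷ᵖ
      (≢-sym (~⇒≢ (b₄ I)) ∷ᵃ []ᵃ) ∷ᵖ
      []ᵃ ∷ᵖ []ᵖ
      where
      hub₂ = rotate hub
      hub₃ = rotate hub₂
      hub₄ = rotate hub₃
      hub₅ = rotate hub₄
      x≢ : ∀ {x} → v ~ x → Allᵛ (x ≢_) (a₅ ∷ᵛ a₁ ∷ᵛ a₂ ∷ᵛ a₃ ∷ᵛ a₄ ∷ᵛ b ∷ᵛ []ᵛ)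
      x≢ vx = separated vx (proj₂ (proj₁ s₅)) ∷ᵃ separated vx (proj₂ (proj₁ s₁)) ∷ᵃ separated vx (proj₂ (proj₁ s₂))
        ∷ᵃ separated vx (proj₂ (proj₁ s₃)) ∷ᵃ separated vx (proj₂ (proj₁ s₄)) ∷ᵃ separated vx v≁b ∷ᵃ []ᵃ

    g-injective : ∀ {i j} → g i ≡ g j → i ≡ j
    g-injective = lookup-injective vertices-unique _ _

    -- The image of `g` is closed under adjacency, since `links i` lists all neighbours of `g i`;
    -- connectedness then makes `g` onto.
    g-reaches : ∀ {u w} → Star _~_ u w → (∃ λ i → g i ≡ u) → ∃ λ i → g i ≡ w
    g-reaches ε            found      = found
    g-reaches (uw ◅ walk) (i , refl) with ∈-map⁻ g (link-cover (links i) uw)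
    ... | j , _ , refl = g-reaches walk (j , refl)

    g-adj : ∀ i j → adj G (g i) (g j) ≡ adj icosahedron i j
    g-adj i j = T-injective to (λ ij → link-adjacent (links i) (∈-map⁺ g (ico-neighbours-complete i j ij)))
      where
      to : g i ~ g j → Adj icosahedron i j
      to gigj with ∈-map⁻ g (link-cover (links i) gigj)
      ... | k , k∈ , gj≡gk = ico-neighbours-sound i j (subst (_∈ ico-neighbours i) (sym (g-injective gj≡gk)) k∈)

    g⁻¹ : V → Fin 12
    g⁻¹ u = proj₁ (g-reaches (connected v u) (0F , refl))

    g∘g⁻¹ : ∀ u → g (g⁻¹ u) ≡ u
    g∘g⁻¹ u = proj₂ (g-reaches (connected v u) (0F , refl))

    icosa⇒icosahedron : Iso G icosahedron
    icosa⇒icosahedron = g⁻¹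
      , ((λ {u} {w} eq → trans (sym (g∘g⁻¹ u)) (trans (cong g eq) (g∘g⁻¹ w)))
        , λ i → g i , λ { refl → g-injective (g∘g⁻¹ (g i)) })
      , λ u w → trans (sym (cong₂ (adj G) (g∘g⁻¹ u) (g∘g⁻¹ w))) (g-adj (g⁻¹ u) (g⁻¹ w))

  -- No neighbour of a wheel is a bowtie, so being a wheel spreads along walks from `v₀` to all
  -- vertices.
  wheels⇒icosahedron : Connected G → (∀ {v} → ¬ IsBowtie v → IsWheel v) → ∀ {v₀} → ¬ IsBowtie v₀ → Iso G icosahedron
  wheels⇒icosahedron connected wheel {v₀} ¬bt₀ with wheel ¬bt₀
  ... | _ , _ , _ , _ , _ , _ , _ , _ , _ , _ , W = icosa⇒icosahedron (proj₂ (wheel⇒icosa wheels W)) connected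
    where
    spread : ∀ {u w} → Star _~_ u w → ¬ IsBowtie u → ¬ IsBowtie w
    spread ε           ¬bt = ¬bt
    spread (uw ◅ walk) ¬bt with wheel ¬bt
    ... | _ , _ , _ , _ , _ , _ , _ , _ , _ , _ , W = spread walk (pentagon-neighbour (Wheel.hub W) uw)

    wheels : ∀ u → IsWheel u
    wheels u = wheel (spread (connected v₀ u) ¬bt₀)

-- The cubic graph of triangles and its line graph

transversal : (R : A → A → Set) → (∀ x y → Dec (R x y)) → (∀ x → R x x) → (xs : List A) →
  Σ ℕ λ m → Σ (Fin m → A) λ rep → (∀ i → rep i ∈ xs) × (∀ {x} → x ∈ xs → ∃ λ i → R (rep i) x) ×
    (∀ i j → R (rep i) (rep j) → R (rep j) (rep i) → i ≡ j)
transversal R R? R-refl [] = 0 , (λ ()) , (λ ()) , (λ ()) , λ ()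
transversal {A} R R? R-refl (x ∷ xs) with transversal R R? R-refl xs
... | m , rep , rep∈ , reached , distinct with any? (λ i → R? (rep i) x)
... | yes (i , ix) = m , rep , there ∘ rep∈ , (λ { 1st → i , ix ; (there y∈) → reached y∈ }) , distinct
-- The head is kept only if no representative from the tail reaches it, so for two different
-- representatives one of the two directions fails.
... | no ∄i = suc m , rep′ , rep′∈ , reached′ , distinct′
  where
  rep′ : Fin (suc m) → A
  rep′ zero    = x
  rep′ (suc i) = rep i
  rep′∈ : ∀ i → rep′ i ∈ x ∷ xs
  rep′∈ zero    = 1st
  rep′∈ (suc i) = there (rep∈ i)
  reached′ : ∀ {y} → y ∈ x ∷ xs → ∃ λ i → R (rep′ i) y
  reached′ 1st = zero , R-refl x
  reached′ (there y∈) with reached y∈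
  ... | i , iy = suc i , iy
  distinct′ : ∀ i j → R (rep′ i) (rep′ j) → R (rep′ j) (rep′ i) → i ≡ j
  distinct′ zero    zero    _  _  = refl
  distinct′ zero    (suc j) _  jx = contradiction (j , jx) ∄i
  distinct′ (suc i) zero    ix _  = contradiction (i , ix) ∄i
  distinct′ (suc i) (suc j) ij ji = cong suc (distinct i j ij ji)

module LineGraph {n} (G : Graph n) (claw-free : ClawFree G) (k₄-free : K₄-Free G) where
  open Local G claw-free k₄-free
  open Bounds G claw-free k₄-free

  infix 4 _∈ᵗ_

  -- A triangle is represented by any one of its edges (a , b).
  _∈ᵗ_ : V → V × V → Set
  u ∈ᵗ (a , b) = u ≡ a ⊎ u ≡ b ⊎ (a ~ u × b ~ u)

  _∈ᵗ?_ : ∀ u e → Dec (u ∈ᵗ e)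
  u ∈ᵗ? (a , b) = u ≟ a ⊎-dec u ≟ b ⊎-dec a ~? u ×-dec b ~? u

  adjacent? : Decidable {A = V × V} λ (a , b) → a ~ b
  adjacent? (a , b) = a ~? b

  edges : List (V × V)
  edges = filter adjacent? (cartesianProduct (allFin n) (allFin n))

  -- Each triangle is named by one base edge and numbered, so that the numbers can serve as vertices
  -- of a `Graph`; `extensional` keeps a triangle from occurring twice.
  record TriangleSystem : Set where
    field
      ∣triangles∣ : ℕ
      base        : Fin ∣triangles∣ → V × V

    On : Fin ∣triangles∣ → V → Set
    On t u = u ∈ᵗ base t

    field
      base-adjacent : ∀ t → proj₁ (base t) ~ proj₂ (base t)
      through       : ∀ {p q} → p ~ q → ∃ λ t → On t p × On t q
      extensional   : ∀ s t → On s (proj₁ (base t)) × On s (proj₂ (base t)) →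
                      On t (proj₁ (base s)) × On t (proj₂ (base s)) → s ≡ t

  triangleSystem : TriangleSystem
  triangleSystem = record
    { ∣triangles∣   = _
    ; base          = _
    ; base-adjacent = λ t → proj₂ (∈-filter⁻ adjacent? {xs = cartesianProduct (allFin n) (allFin n)} (base∈ t))
    ; through       = λ pq → reached (∈-filter⁺ adjacent? (∈-cartesianProduct⁺ (∈-allFin _) (∈-allFin _)) pq)
    ; extensional   = distinct
    }
    where
    triangles = transversal (λ e (a , b) → a ∈ᵗ e × b ∈ᵗ e) (λ e (a , b) → a ∈ᵗ? e ×-dec b ∈ᵗ? e)
      (λ e → inj₁ refl , inj₂ (inj₁ refl)) edges
    base∈    = proj₁ (proj₂ (proj₂ triangles))
    reached  = proj₁ (proj₂ (proj₂ (proj₂ triangles)))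
    distinct = proj₂ (proj₂ (proj₂ (proj₂ triangles)))

  module Triangles (bowties : ∀ u → IsBowtie u) (𝒯 : TriangleSystem) where
    open TriangleSystem 𝒯

    Triangle : Set
    Triangle = Fin ∣triangles∣

    -- Only the last case uses bowties: two apexes over the same base coincide, since an edge lies
    -- in one triangle.
    triangle-adjacent : ∀ {a b p q} → a ~ b → p ∈ᵗ (a , b) → q ∈ᵗ (a , b) → p ≢ q → p ~ q
    triangle-adjacent ab (inj₁ refl) (inj₁ refl) p≢q = contradiction refl p≢q
    triangle-adjacent ab (inj₁ refl) (inj₂ (inj₁ refl)) _ = ab
    triangle-adjacent ab (inj₁ refl) (inj₂ (inj₂ (aq , _))) _ = aq
    triangle-adjacent ab (inj₂ (inj₁ refl)) (inj₁ refl) _ = ~-sym ab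
    triangle-adjacent ab (inj₂ (inj₁ refl)) (inj₂ (inj₁ refl)) p≢q = contradiction refl p≢q
    triangle-adjacent ab (inj₂ (inj₁ refl)) (inj₂ (inj₂ (_ , bq))) _ = bq
    triangle-adjacent ab (inj₂ (inj₂ (ap , _))) (inj₁ refl) _ = ~-sym ap
    triangle-adjacent ab (inj₂ (inj₂ (_ , bp))) (inj₂ (inj₁ refl)) _ = ~-sym bp
    triangle-adjacent ab (inj₂ (inj₂ (ap , bp))) (inj₂ (inj₂ (aq , bq))) p≢q =
      contradiction (bowtie-unique (bowties _) ab ap aq bp bq) p≢q

    triangle-closed : ∀ {a b p q u} → a ~ b → p ∈ᵗ (a , b) → q ∈ᵗ (a , b) → p ≢ q → p ~ u → q ~ u → u ∈ᵗ (a , b)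
    triangle-closed ab (inj₁ refl) (inj₁ refl) p≢q _ _ = contradiction refl p≢q
    triangle-closed ab (inj₁ refl) (inj₂ (inj₁ refl)) _ au bu = inj₂ (inj₂ (au , bu))
    triangle-closed ab (inj₁ refl) (inj₂ (inj₂ (aq , bq))) _ au qu =
      inj₂ (inj₁ (bowtie-unique (bowties _) aq au ab qu (~-sym bq)))
    triangle-closed ab (inj₂ (inj₁ refl)) (inj₁ refl) _ bu au = inj₂ (inj₂ (au , bu))
    triangle-closed ab (inj₂ (inj₁ refl)) (inj₂ (inj₁ refl)) p≢q _ _ = contradiction refl p≢q
    triangle-closed ab (inj₂ (inj₁ refl)) (inj₂ (inj₂ (aq , bq))) _ bu qu =
      inj₁ (bowtie-unique (bowties _) bq bu (~-sym ab) qu (~-sym aq))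
    triangle-closed ab (inj₂ (inj₂ (ap , bp))) (inj₁ refl) _ pu au =
      inj₂ (inj₁ (bowtie-unique (bowties _) ap au ab pu (~-sym bp)))
    triangle-closed ab (inj₂ (inj₂ (ap , bp))) (inj₂ (inj₁ refl)) _ pu bu =
      inj₁ (bowtie-unique (bowties _) bp bu (~-sym ab) pu (~-sym ap))
    triangle-closed ab (inj₂ (inj₂ (ap , bp))) (inj₂ (inj₂ (aq , bq))) p≢q _ _ =
      contradiction (bowtie-unique (bowties _) ab ap aq bp bq) p≢q

    on-adjacent : ∀ t {p q} → On t p → On t q → p ≢ q → p ~ q
    on-adjacent t = triangle-adjacent (base-adjacent t)

    on-closed : ∀ t {p q u} → On t p → On t q → p ≢ q → p ~ u → q ~ u → On t u
    on-closed t = triangle-closed (base-adjacent t)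

    on-transfer : ∀ s t {p q u} → p ≢ q → On s p → On s q → On t p → On t q → On t u → On s u
    on-transfer s t {p} {q} {u} p≢q sp sq tp tq tu with p ≟ u | q ≟ u
    ... | yes refl | _        = sp
    ... | no _     | yes refl = sq
    ... | no p≢u   | no q≢u   = on-closed s sp sq p≢q (on-adjacent t tp tu p≢u) (on-adjacent t tq tu q≢u)

    -- Two triangles with two common vertices agree by `on-transfer`. In particular each contains
    -- the base of the other, which is what `extensional` asks for.
    through-unique : ∀ s t {p q} → p ≢ q → On s p → On s q → On t p → On t q → s ≡ t
    through-unique s t p≢q sp sq tp tq = extensional s t
      (on-transfer s t p≢q sp sq tp tq (inj₁ refl) , on-transfer s t p≢q sp sq tp tq (inj₂ (inj₁ refl)))
      (on-transfer t s p≢q tp tq sp sq (inj₁ refl) , on-transfer t s p≢q tp tq sp sq (inj₂ (inj₁ refl)))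

    corners : ∀ t → ∃ λ a → ∃ λ b → ∃ λ c → (a ~ b × a ~ c × b ~ c) × (On t a × On t b × On t c) ×
      (∀ u → On t u → u ∈ a ∷ b ∷ c ∷ [])
    corners t with bowtie-at (bowties (proj₁ (base t))) (base-adjacent t)
    ... | c , _ , _ , B = _ , _ , c , (va , vb , ab) , (inj₁ refl , inj₂ (inj₁ refl) , inj₂ (inj₂ (vb , ab))) , cover′
      where
      open Bowtie B
      cover′ : ∀ u → On t u → u ∈ _
      cover′ u (inj₁ refl)              = 1st
      cover′ u (inj₂ (inj₁ refl))       = 2nd
      cover′ u (inj₂ (inj₂ (au , bu))) = there (there (here (bowtie-mate B au bu)))

    another-corner : ∀ t p → ∃ λ q → On t q × p ≢ q
    another-corner t p with corners t
    ... | a , b , _ , (ab , _) , (ta , tb , _) , _ with p ≟ a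
    ... | yes refl = b , tb , ~⇒≢ ab
    ... | no  p≢a  = a , ta , p≢a

    -- These are the two wings of the bowtie at `p`, in increasing order because `IsLineGraphOf`
    -- writes edges as increasing pairs.
    triangles-at : ∀ p → ∃₂ λ s t → toℕ s < toℕ t × On s p × On t p × (∀ r → On r p → r ≡ s ⊎ r ≡ t)
    triangles-at p with bowties p
    ... | a , b , c , d , B with through (Bowtie.va B) | through (Bowtie.vc B)
    ... | s , sp , sa | t , tp , tc = order (<-cmp (toℕ s) (toℕ t))
      where
      open Bowtie B
      s≢t : s ≢ t
      s≢t refl = a≁c (on-adjacent s sa tc (separated (~-sym ab) b≁c))
      only : ∀ r → On r p → r ≡ s ⊎ r ≡ t
      -- A second corner of `r` is a neighbour of `p`, so it lies on a wing, and two common vertices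
      -- identify `r` with that wing.
      only r rp with another-corner r p
      ... | q , rq , p≢q with cover q (on-adjacent r rp rq p≢q)
      ... | 1st = inj₁ (through-unique r s p≢q rp rq sp sa)
      ... | 2nd = inj₁ (through-unique r s p≢q rp rq sp (on-closed s sp sa (~⇒≢ va) vb ab))
      ... | 3rd = inj₂ (through-unique r t p≢q rp rq tp tc)
      ... | 4th = inj₂ (through-unique r t p≢q rp rq tp (on-closed t tp tc (~⇒≢ vc) vd cd))
      order : Tri (toℕ s < toℕ t) (toℕ s ≡ toℕ t) (toℕ t < toℕ s) → _
      order (tri< s<t _ _) = s , t , s<t , sp , tp , only
      order (tri≈ _ s≡t _) = contradiction (toℕ-injective s≡t) s≢t
      order (tri> _ _ t<s) = t , s , t<s , tp , sp , λ r rp → swap (only r rp)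

    other-triangle : ∀ t p → On t p → ∃ λ s → t ≢ s × On s p × (∀ r → On r p → t ≢ r → r ≡ s)
    other-triangle t p tp with triangles-at p
    ... | s₁ , s₂ , s₁<s₂ , on₁ , on₂ , only with only t tp
    ... | inj₁ refl = s₂ , (λ { refl → <-irrefl refl s₁<s₂ }) , on₂ ,
      λ r rp t≢r → [ (λ r≡t → contradiction (sym r≡t) t≢r) , (λ r≡s → r≡s) ]′ (only r rp)
    ... | inj₂ refl = s₁ , (λ { refl → <-irrefl refl s₁<s₂ }) , on₁ ,
      λ r rp t≢r → [ (λ r≡s → r≡s) , (λ r≡t → contradiction (sym r≡t) t≢r) ]′ (only r rp)

    Meet : Triangle → Triangle → Set
    Meet s t = s ≢ t × ∃ λ u → On s u × On t u

    on? : ∀ t u → Dec (On t u)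
    on? t u = u ∈ᵗ? base t

    meet? : ∀ s t → Dec (Meet s t)
    meet? s t = ¬? (s ≟ t) ×-dec any? λ u → on? s u ×-dec on? t u

    F : Graph ∣triangles∣
    F = record
      { adj    = λ s t → ⌊ meet? s t ⌋
      ; sym    = λ s t → T-injective (meet-sym s t) (meet-sym t s)
      ; irrefl = λ t → T-injective (λ tt → proj₁ (toWitness tt) refl) ⊥-elim
      }
      where
      meet-sym : ∀ s t → T ⌊ meet? s t ⌋ → T ⌊ meet? t s ⌋
      meet-sym s t st with toWitness st
      ... | s≢t , u , su , tu = fromWitness (≢-sym s≢t , u , tu , su)

    -- The neighbours of `t` are the second triangles at its three corners. If two of them agreed,
    -- that triangle would share two corners with `t` and be `t` itself.
    F-cubic : Cubic F
    F-cubic t with corners t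
    ... | a , b , c , (ab , ac , bc) , (ta , tb , tc) , cover
      with other-triangle t a ta | other-triangle t b tb | other-triangle t c tc
    ... | sᵃ , t≢sᵃ , sa , onlyᵃ | sᵇ , t≢sᵇ , sb , onlyᵇ | sᶜ , t≢sᶜ , sc , onlyᶜ =
      count-≡ (adj F t) (sᵃ ∷ sᵇ ∷ sᶜ ∷ [])
        (((λ { refl → t≢sᵃ (through-unique t sᵃ (~⇒≢ ab) ta tb sa sb) }) ∷
          (λ { refl → t≢sᵃ (through-unique t sᵃ (~⇒≢ ac) ta tc sa sc) }) ∷ []) ∷
         ((λ { refl → t≢sᵇ (through-unique t sᵇ (~⇒≢ bc) tb tc sb sc) }) ∷ []) ∷ [] ∷ [])
        (fromWitness (t≢sᵃ , a , ta , sa) ∷ fromWitness (t≢sᵇ , b , tb , sb) ∷ fromWitness (t≢sᶜ , c , tc , sc) ∷ [])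
        F-cover
      where
      F-cover : ∀ s → Adj F t s → s ∈ sᵃ ∷ sᵇ ∷ sᶜ ∷ []
      F-cover s ts with toWitness ts
      ... | t≢s , u , tu , su with cover u tu
      ... | 1st = here (onlyᵃ s su t≢s)
      ... | 2nd = there (here (onlyᵇ s su t≢s))
      ... | 3rd = there (there (here (onlyᶜ s su t≢s)))

    ends : V → Triangle × Triangle
    ends p = proj₁ (triangles-at p) , proj₁ (proj₂ (triangles-at p))

    G-lineGraph : IsLineGraphOf G F
    G-lineGraph = ends , valid , injective , onto , λ x y → to x y , from x y
      where
      valid : ∀ x → toℕ (proj₁ (ends x)) < toℕ (proj₂ (ends x)) × Adj F (proj₁ (ends x)) (proj₂ (ends x))
      valid x with triangles-at x
      ... | s , t , s<t , sx , tx , _ = s<t , fromWitness ((λ { refl → <-irrefl refl s<t }) , x , sx , tx)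

      injective : ∀ {x y} → ends x ≡ ends y → x ≡ y
      injective {x} {y} eq with triangles-at x | triangles-at y
      injective {x} {y} refl | s , t , s<t , sx , tx , _ | _ , _ , _ , sy , ty , _ with x ≟ y
      ... | yes x≡y = x≡y
      -- Both ends would contain `x` and `y`, hence be the same triangle, against `s<t`.
      ... | no  x≢y = contradiction s<t (<-irrefl (cong toℕ (through-unique s t x≢y sx sy tx ty)))

      onto : ∀ s t → toℕ s < toℕ t → Adj F s t → ∃ λ x → ends x ≡ (s , t)
      onto s t s<t st with toWitness st
      ... | s≢t , x , sx , tx = x , ends≡
        where
        ends≡ : ends x ≡ (s , t)
        ends≡ with triangles-at x
        ... | s′ , t′ , s′<t′ , _ , _ , only with only s sx | only t tx
        ... | inj₁ refl | inj₁ refl = contradiction refl s≢t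
        ... | inj₁ refl | inj₂ refl = refl
        ... | inj₂ refl | inj₁ refl = contradiction s′<t′ (<-asym s<t)
        ... | inj₂ refl | inj₂ refl = contradiction refl s≢t

      Incident : V → V → Set
      Incident x y = let (a , b) = ends x ; (c , d) = ends y in a ≡ c ⊎ a ≡ d ⊎ b ≡ c ⊎ b ≡ d

      to : ∀ x y → x ~ y → x ≢ y × Incident x y
      to x y xy with through xy | triangles-at x | triangles-at y
      ... | r , rx , ry | _ , _ , _ , _ , _ , onlyˣ | _ , _ , _ , _ , _ , onlyʸ with onlyˣ r rx | onlyʸ r ry
      ... | inj₁ refl | inj₁ refl = ~⇒≢ xy , inj₁ refl
      ... | inj₁ refl | inj₂ refl = ~⇒≢ xy , inj₂ (inj₁ refl)
      ... | inj₂ refl | inj₁ refl = ~⇒≢ xy , inj₂ (inj₂ (inj₁ refl))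
      ... | inj₂ refl | inj₂ refl = ~⇒≢ xy , inj₂ (inj₂ (inj₂ refl))

      from : ∀ x y → x ≢ y × Incident x y → x ~ y
      from x y (x≢y , inc) with triangles-at x | triangles-at y
      from x y (x≢y , inj₁ refl) | s , t , _ , sx , tx , _ | _ , _ , _ , s′y , t′y , _ = on-adjacent s sx s′y x≢y
      from x y (x≢y , inj₂ (inj₁ refl)) | s , t , _ , sx , tx , _ | _ , _ , _ , s′y , t′y , _ = on-adjacent s sx t′y x≢y
      from x y (x≢y , inj₂ (inj₂ (inj₁ refl))) | s , t , _ , sx , tx , _ | _ , _ , _ , s′y , t′y , _ = on-adjacent t tx s′y x≢y
      from x y (x≢y , inj₂ (inj₂ (inj₂ refl))) | s , t , _ , sx , tx , _ | _ , _ , _ , s′y , t′y , _ = on-adjacent t tx t′y x≢y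

  bowties⇒lineGraph : (∀ u → IsBowtie u) → Σ ℕ λ m → Σ (Graph m) λ F → Cubic F × IsLineGraphOf G F
  bowties⇒lineGraph bowties = _ , F , F-cubic , G-lineGraph
    where open Triangles bowties triangleSystem

-- Assembling the three outcomes

theorem4p1 : ∀ {n} (G : Graph (suc n)) → Connected G → ClawFree G → CliqueNumber G 3 →
    Iso G icosahedron
    ⊎ (Σ ℕ λ m → Σ (Graph m) λ F → Cubic F × IsLineGraphOf G F)
    ⊎ (∃ λ v → deg² G v ≤ 9
    × (∀ x → Adj G v x → deg² G x ≤ 11)
    × ((∃ λ x* → Adj G v x* × deg² G x* ≤ 10)
    ⊎ (∀ x y → x ≢ y → Adj G v (punchIn v x) → Adj G v (punchIn v y) →
    SqAdj (delete G v) x y)))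
theorem4p1 {n} G connected claw-free (_ , ω≤3) = trichotomy (all? bowtie?) (any? λ v → ¬? (bowtie? v) ×-dec deg² G v ≤? 9)
  where
  k₄-free = ω≤3⇒K₄-free G ω≤3
  open Local G claw-free k₄-free
  open Bounds G claw-free k₄-free
  open Icosahedral G claw-free k₄-free
  open Isomorphism G claw-free k₄-free
  open LineGraph G claw-free k₄-free

  Good : V → Set
  Good v = deg² G v ≤ 9
    × (∀ x → v ~ x → deg² G x ≤ 11)
    × ((∃ λ x* → v ~ x* × deg² G x* ≤ 10)
    ⊎ (∀ x y → x ≢ y → v ~ punchIn v x → v ~ punchIn v y → SqAdj (delete G v) x y))

  good : ∀ {v} → ¬ IsBowtie v → deg² G v ≤ 9 → Good v
  good {v} ¬bt ≤9 = ≤9 , (λ _ → neighbour-deg² ¬bt) , furthermore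
    where
    furthermore : _ ⊎ _
    furthermore with any? (λ x → v ~? x ×-dec deg² G x ≤? 10)
    ... | yes x*  = inj₁ x*
    -- Any two neighbours are already adjacent in `G`, by an edge that avoids `v` and so survives
    -- its deletion.
    ... | no ∄x* = inj₂ λ x y x≢y vx vy → Equivalence.from T-∧
      (fromWitnessFalse x≢y , Equivalence.from T-∨ (inj₁
        (bowtie-neighbours⇒clique ¬bt bowties vx vy (x≢y ∘ punchIn-injective v x y))))
      where
      bowties : ∀ x → v ~ x → IsBowtie x
      bowties x vx = decidable-stable (bowtie? x) λ ¬btx → ∄x* (x , vx , non-bowtie-deg² ¬btx)

  trichotomy : Dec (∀ v → IsBowtie v) → Dec (∃ λ v → ¬ IsBowtie v × deg² G v ≤ 9) →
    Iso G icosahedron ⊎ (Σ ℕ λ m → Σ (Graph m) λ F → Cubic F × IsLineGraphOf G F) ⊎ ∃ Good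
  trichotomy (yes bowties) _                    = inj₂ (inj₁ (bowties⇒lineGraph bowties))
  trichotomy (no _)        (yes (v , ¬bt , ≤9)) = inj₂ (inj₂ (v , good ¬bt ≤9))
  trichotomy (no ¬bowties) (no ∄v)              = inj₁ (wheels⇒icosahedron connected wheel
    (proj₂ (¬∀⟶∃¬ _ IsBowtie bowtie? ¬bowties)))
    where
    wheel : ∀ {v} → ¬ IsBowtie v → IsWheel v
    -- With no non-bowtie of square degree at most 9, `classify` leaves only wheels.
    wheel {v} ¬bt = [ (λ ≤9 → contradiction (v , ¬bt , ≤9) ∄v) , id ]′ (classify v ¬bt)
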